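{- Let $(P,\rho,\bar\zeta)$ be an Eulerian quasi-graded poset with minimal element $\hat0$ and maximal element $\hat1$, $\hat0<\hat1$. Then its $\mathbf{ab}$-index $\Psi(P,\rho,\bar\zeta)$ can be written uniquely as a polynomial in the non-commutative variables $\mathbf c=\mathbf a+\mathbf b$ and $\mathbf d=\mathbf a\mathbf b+\mathbf b\mathbf a$. Furthermore, if $\bar\zeta$ is integer-valued, then this polynomial in $\mathbf c$ and $\mathbf d$ (the $\mathbf{cd}$-index) has only integer coefficients.
   Context: A quasi-graded poset $(P,\rho,\bar\zeta)$ consists of a finite poset $P$, a function $\rho:P\to\mathbb N$ with $x<y\Rightarrow\rho(x)<\rho(y)$, and a complex-valued function $\bar\zeta$ in the incidence algebra of $P$ with $\bar\zeta(x,x)=1$ for all $x$. Write $\rho(x,y)=\rho(y)-\rho(x)$. It is Eulerian if for all $x\le z$ $$\sum_{x\le y\le z}(-1)^{\rho(x,y)}\,\bar\zeta(x,y)\,\bar\zeta(y,z)=\delta_{x,z}.$$ If $P$ has a minimal element $\hat0$ and a maximal element $\hat1$ with $\hat0<\hat1$, its $\mathbf{ab}$-index is the polynomial in non-commuting variables $\mathbf a,\mathbf b$ $$\Psi(P,\rho,\bar\zeta)=\sum_{c}\bar\zeta(x_0,x_1)\cdots\bar\zeta(x_{k-1},x_k)\cdot(\mathbf a-\mathbf b)^{\rho(x_0,x_1)-1}\,\mathbf b\,(\mathbf a-\mathbf b)^{\rho(x_1,x_2)-1}\,\mathbf b\cdots\mathbf b\,(\mathbf a-\mathbf b)^{\rho(x_{k-1},x_k)-1},$$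 the sum being over all chains $c=\{\hat0=x_0<x_1<\cdots<x_k=\hat1\}$, $k\ge1$. -}

module Defs where

open import Level using (0ℓ)
open import Algebra.Bundles using (CommutativeRing; Semiring)
import Algebra.Definitions.RawSemiring as RawSemiringDefs
open import Data.Bool.Base using (if_then_else_)
open import Data.Fin.Base using (Fin)
open import Data.Integer.Base as ℤ using (ℤ)
open import Data.List.Base using (List; []; _∷_; [_]; _++_; map; foldr; filter; concatMap; cartesianProductWith; allFin; upTo)
open import Data.List.Properties using (≡-dec)
open import Data.Nat.Base as ℕ using (ℕ; zero; suc; _∸_; _⊔_)
import Data.Nat.Properties as ℕ
open import Data.Product.Base using (∃; _×_; _,_)
open import Data.Rational.Base as ℚ using (ℚ; 0ℚ; 1ℚ; ½)
import Data.Rational.Properties as ℚ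
import Data.Rational.Solver as ℚ-Solver
open import Function.Bundles using (_↔_; Inverse)
open import Relation.Binary.Core using (Rel)
open import Relation.Binary.Definitions using (DecidableEquality)
open import Relation.Binary.Structures using (IsDecPartialOrder)
import Relation.Binary.Construct.NonStrictToStrict as ToStrict
open import Relation.Binary.PropositionalEquality using (_≡_; refl; sym; trans; cong; subst)
open import Relation.Nullary using (¬_; Dec; yes; no; does)
open import Relation.Nullary.Decidable using (_×-dec_)

-- ℝ is the ring of rational Cauchy sequences modulo null sequences; the
-- quotient is expressed by the setoid equality _≃_.

module Real where

  Null : (ℕ → ℚ) → Set
  Null s = ∀ ε → 0ℚ ℚ.< ε → ∃ λ N → ∀ n → N ℕ.≤ n → ℚ.∣ s n ∣ ℚ.< ε

  -- Without η and with operations defined by copatterns, terms such as x + y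
  -- stay folded during conversion checking.
  record ℝ : Set where
    no-eta-equality
    field
      seq    : ℕ → ℚ
      cauchy : ∀ ε → 0ℚ ℚ.< ε →
               ∃ λ N → ∀ m n → N ℕ.≤ m → N ℕ.≤ n → ℚ.∣ seq m ℚ.- seq n ∣ ℚ.< ε

  open ℝ public

  infix 4 _≃_

  record _≃_ (x y : ℝ) : Set where
    constructor mk≃
    field
      null : Null (λ n → seq x n ℚ.- seq y n)

  open _≃_ public

  private
    open ℚ-Solver.+-*-Solver

    half : ∀ {ε} → 0ℚ ℚ.< ε → 0ℚ ℚ.< ε ℚ.* ½
    half {ε} 0<ε = subst (ℚ._< ε ℚ.* ½) (ℚ.*-zeroˡ ½) (ℚ.*-monoˡ-<-pos ½ 0<ε)

    halves : ∀ ε → ε ℚ.* ½ ℚ.+ ε ℚ.* ½ ≡ ε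
    halves ε = trans (sym (ℚ.*-distribˡ-+ ε ½ ½)) (ℚ.*-identityʳ ε)

    sum-small : ∀ {ε p q} → ℚ.∣ p ∣ ℚ.< ε ℚ.* ½ → ℚ.∣ q ∣ ℚ.< ε ℚ.* ½ → ℚ.∣ p ℚ.+ q ∣ ℚ.< ε
    sum-small {ε} {p} {q} p< q< =
      ℚ.≤-<-trans (ℚ.∣p+q∣≤∣p∣+∣q∣ p q) (subst (ℚ.∣ p ∣ ℚ.+ ℚ.∣ q ∣ ℚ.<_) (halves ε) (ℚ.+-mono-< p< q<))

    divide : ∀ {B ε} → 0ℚ ℚ.< B → 0ℚ ℚ.< ε → ∃ λ δ → 0ℚ ℚ.< δ × B ℚ.* δ ≡ ε
    divide {B} {ε} 0<B 0<ε = 1/B ℚ.* ε , 0<δ , eq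
      where
      instance
        B-pos = ℚ.positive 0<B
        B-nz  = ℚ.pos⇒nonZero B
      1/B = ℚ.1/ B
      instance
        1/B-pos = ℚ.1/pos⇒pos B
      0<δ : 0ℚ ℚ.< 1/B ℚ.* ε
      0<δ = subst (ℚ._< 1/B ℚ.* ε) (ℚ.*-zeroʳ 1/B) (ℚ.*-monoʳ-<-pos 1/B 0<ε)
      eq : B ℚ.* (1/B ℚ.* ε) ≡ ε
      eq = trans (sym (ℚ.*-assoc B 1/B ε)) (trans (cong (ℚ._* ε) (ℚ.*-inverseʳ B)) (ℚ.*-identityˡ ε))

    mul-small : ∀ {B δ η a p} → 0ℚ ℚ.< B → B ℚ.* δ ≡ η →
                ℚ.∣ a ∣ ℚ.< B → ℚ.∣ p ∣ ℚ.< δ → ℚ.∣ a ℚ.* p ∣ ℚ.< η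
    mul-small {B} {δ} {η} {a} {p} 0<B Bδ≡η a<B p<δ =
      subst (ℚ._< η) (sym (ℚ.∣p*q∣≡∣p∣*∣q∣ a p))
        (ℚ.≤-<-trans (ℚ.*-monoʳ-≤-nonNeg ℚ.∣ p ∣ {{ℚ.∣-∣-nonNeg p}} (ℚ.<⇒≤ a<B))
          (subst (B ℚ.* ℚ.∣ p ∣ ℚ.<_) Bδ≡η (ℚ.*-monoʳ-<-pos B {{ℚ.positive 0<B}} p<δ)))

    ∣-∣-swap : ∀ p q → ℚ.∣ p ℚ.- q ∣ ≡ ℚ.∣ q ℚ.- p ∣
    ∣-∣-swap p q = trans (sym (ℚ.∣-p∣≡∣p∣ (p ℚ.- q)))
      (cong ℚ.∣_∣ (solve 2 (λ p q → :- (p :- q) := q :- p) refl p q))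

    bounded : ∀ x → ∃ λ B → 0ℚ ℚ.< B × ∃ λ N → ∀ n → N ℕ.≤ n → ℚ.∣ seq x n ∣ ℚ.< B
    bounded x with cauchy x 1ℚ (ℚ.positive⁻¹ 1ℚ)
    ... | N , close = 1ℚ ℚ.+ ℚ.∣ seq x N ∣
      , ℚ.+-mono-<-≤ (ℚ.positive⁻¹ 1ℚ) (ℚ.0≤∣p∣ (seq x N))
      , N , λ n N≤n → ℚ.≤-<-trans
          (subst (λ t → ℚ.∣ t ∣ ℚ.≤ ℚ.∣ seq x n ℚ.- seq x N ∣ ℚ.+ ℚ.∣ seq x N ∣)
            (solve 2 (λ a b → a :- b :+ b := a) refl (seq x n) (seq x N))
            (ℚ.∣p+q∣≤∣p∣+∣q∣ (seq x n ℚ.- seq x N) (seq x N)))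
          (ℚ.+-mono-<-≤ (close n N N≤n ℕ.≤-refl) ℚ.≤-refl)

    ≤ˡ : ∀ {m n k} → m ⊔ n ℕ.≤ k → m ℕ.≤ k
    ≤ˡ {m} {n} = ℕ.m⊔n≤o⇒m≤o m n

    ≤ʳ : ∀ {m n k} → m ⊔ n ℕ.≤ k → n ℕ.≤ k
    ≤ʳ {m} {n} = ℕ.m⊔n≤o⇒n≤o m n

    +-regroup : ∀ a b c d → (a ℚ.- b) ℚ.+ (c ℚ.- d) ≡ (a ℚ.+ c) ℚ.- (b ℚ.+ d)
    +-regroup = solve 4 (λ a b c d → (a :- b) :+ (c :- d) := (a :+ c) :- (b :+ d)) refl

    *-regroup : ∀ a b c d → a ℚ.* (c ℚ.- d) ℚ.+ d ℚ.* (a ℚ.- b) ≡ a ℚ.* c ℚ.- b ℚ.* d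
    *-regroup = solve 4 (λ a b c d → a :* (c :- d) :+ d :* (a :- b) := a :* c :- b :* d) refl

    neg-regroup : ∀ a b → b ℚ.- a ≡ ℚ.- a ℚ.- (ℚ.- b)
    neg-regroup = solve 2 (λ a b → b :- a := :- a :- (:- b)) refl

    small : ∀ {ε p q} → p ≡ q → ℚ.∣ p ∣ ℚ.< ε → ℚ.∣ q ∣ ℚ.< ε
    small {ε} = subst (λ t → ℚ.∣ t ∣ ℚ.< ε)

  pointwise : ∀ {x y} → (∀ n → seq x n ≡ seq y n) → x ≃ y
  pointwise {x} {y} eq = mk≃ λ ε 0<ε → 0 , λ n _ →
    small {p = 0ℚ} (trans (sym (ℚ.+-inverseʳ (seq y n))) (cong (ℚ._- seq y n) (sym (eq n)))) 0<ε

  fromℚ : ℚ → ℝ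
  seq    (fromℚ q) _ = q
  cauchy (fromℚ q) ε 0<ε = 0 , λ _ _ _ _ → small (sym (ℚ.+-inverseʳ q)) 0<ε

  infixl 6 _+_
  infixl 7 _*_
  infix  8 -_

  _+_ : ℝ → ℝ → ℝ
  seq    (x + y) n = seq x n ℚ.+ seq y n
  cauchy (x + y) ε 0<ε =
    let M , x-close = cauchy x (ε ℚ.* ½) (half 0<ε)
        N , y-close = cauchy y (ε ℚ.* ½) (half 0<ε)
    in M ⊔ N , λ m n m≥ n≥ →
      small (+-regroup (seq x m) (seq x n) (seq y m) (seq y n))
        (sum-small {p = seq x m ℚ.- seq x n} {q = seq y m ℚ.- seq y n}
          (x-close m n (≤ˡ m≥) (≤ˡ n≥)) (y-close m n (≤ʳ {M} m≥) (≤ʳ {M} n≥)))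

  -_ : ℝ → ℝ
  seq    (- x) n = ℚ.- seq x n
  cauchy (- x) ε 0<ε =
    let N , close = cauchy x ε 0<ε
    in N , λ m n m≥ n≥ → small (neg-regroup (seq x m) (seq x n)) (close n m n≥ m≥)

  _*_ : ℝ → ℝ → ℝ
  seq    (x * y) n = seq x n ℚ.* seq y n
  cauchy (x * y) ε 0<ε =
    let A , 0<A , K , x-bound = bounded x
        B , 0<B , L , y-bound = bounded y
        α , 0<α , Aα≡ = divide 0<A (half 0<ε)
        β , 0<β , Bβ≡ = divide 0<B (half 0<ε)
        M , x-close = cauchy x β 0<β
        N , y-close = cauchy y α 0<α
    in (K ⊔ L) ⊔ (M ⊔ N) , λ m n m≥ n≥ →
      small (*-regroup (seq x m) (seq x n) (seq y m) (seq y n))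
        (sum-small {p = seq x m ℚ.* (seq y m ℚ.- seq y n)} {q = seq y n ℚ.* (seq x m ℚ.- seq x n)}
          (mul-small {a = seq x m} 0<A Aα≡ (x-bound m (≤ˡ {K} (≤ˡ {K ⊔ L} m≥)))
            (y-close m n (≤ʳ {M} (≤ʳ {K ⊔ L} m≥)) (≤ʳ {M} (≤ʳ {K ⊔ L} n≥))))
          (mul-small {a = seq y n} 0<B Bβ≡ (y-bound n (≤ʳ {K} (≤ˡ {K ⊔ L} n≥)))
            (x-close m n (≤ˡ {M} (≤ʳ {K ⊔ L} m≥)) (≤ˡ {M} (≤ʳ {K ⊔ L} n≥)))))

  private
    ≃-refl : ∀ {x} → x ≃ x
    ≃-refl = pointwise λ _ → refl

    ≃-sym : ∀ {x y} → x ≃ y → y ≃ x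
    ≃-sym {x} {y} (mk≃ xy) = mk≃ λ ε 0<ε →
      let N , close = xy ε 0<ε
      in N , λ n n≥ → subst (ℚ._< ε) (∣-∣-swap (seq x n) (seq y n)) (close n n≥)

    ≃-trans : ∀ {x y z} → x ≃ y → y ≃ z → x ≃ z
    ≃-trans {x} {y} {z} (mk≃ xy) (mk≃ yz) = mk≃ λ ε 0<ε →
      let M , xy-close = xy (ε ℚ.* ½) (half 0<ε)
          N , yz-close = yz (ε ℚ.* ½) (half 0<ε)
      in M ⊔ N , λ n n≥ →
        small (solve 3 (λ a b c → (a :- b) :+ (b :- c) := a :- c) refl (seq x n) (seq y n) (seq z n))
          (sum-small {p = seq x n ℚ.- seq y n} {q = seq y n ℚ.- seq z n}
            (xy-close n (≤ˡ n≥)) (yz-close n (≤ʳ {M} n≥)))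

    +-cong : ∀ {x x′ y y′} → x ≃ x′ → y ≃ y′ → x + y ≃ x′ + y′
    +-cong {x} {x′} {y} {y′} (mk≃ p) (mk≃ q) = mk≃ λ ε 0<ε →
      let M , p-close = p (ε ℚ.* ½) (half 0<ε)
          N , q-close = q (ε ℚ.* ½) (half 0<ε)
      in M ⊔ N , λ n n≥ →
        small (+-regroup (seq x n) (seq x′ n) (seq y n) (seq y′ n))
          (sum-small {p = seq x n ℚ.- seq x′ n} {q = seq y n ℚ.- seq y′ n}
            (p-close n (≤ˡ n≥)) (q-close n (≤ʳ {M} n≥)))

    -‿cong : ∀ {x y} → x ≃ y → - x ≃ - y
    -‿cong {x} {y} p = mk≃ λ ε 0<ε →
      let N , close = null (≃-sym p) ε 0<ε
      in N , λ n n≥ → small (neg-regroup (seq x n) (seq y n)) (close n n≥)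

    *-cong : ∀ {x x′ y y′} → x ≃ x′ → y ≃ y′ → x * y ≃ x′ * y′
    *-cong {x} {x′} {y} {y′} (mk≃ p) (mk≃ q) = mk≃ λ ε 0<ε →
      let A , 0<A , K , x-bound = bounded x
          B , 0<B , L , y-bound = bounded y′
          α , 0<α , Aα≡ = divide 0<A (half 0<ε)
          β , 0<β , Bβ≡ = divide 0<B (half 0<ε)
          M , p-close = p β 0<β
          N , q-close = q α 0<α
      in (K ⊔ L) ⊔ (M ⊔ N) , λ n n≥ →
        small (*-regroup (seq x n) (seq x′ n) (seq y n) (seq y′ n))
          (sum-small {p = seq x n ℚ.* (seq y n ℚ.- seq y′ n)} {q = seq y′ n ℚ.* (seq x n ℚ.- seq x′ n)}
            (mul-small {a = seq x n} 0<A Aα≡ (x-bound n (≤ˡ {K} (≤ˡ {K ⊔ L} n≥)))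
              (q-close n (≤ʳ {M} (≤ʳ {K ⊔ L} n≥))))
            (mul-small {a = seq y′ n} 0<B Bβ≡ (y-bound n (≤ʳ {K} (≤ˡ {K ⊔ L} n≥)))
              (p-close n (≤ˡ {M} (≤ʳ {K ⊔ L} n≥)))))

  ℝ-commutativeRing : CommutativeRing 0ℓ 0ℓ
  ℝ-commutativeRing = record
    { Carrier = ℝ
    ; _≈_ = _≃_
    ; _+_ = _+_
    ; _*_ = _*_
    ; -_  = -_
    ; 0#  = fromℚ 0ℚ
    ; 1#  = fromℚ 1ℚ
    ; isCommutativeRing = record
      { isRing = record
        { +-isAbelianGroup = record
          { isGroup = record
            { isMonoid = record
              { isSemigroup = record
                { isMagma = record
                  { isEquivalence = record { refl = ≃-refl ; sym = ≃-sym ; trans = ≃-trans }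
                  ; ∙-cong = +-cong
                  }
                ; assoc = λ x y z → pointwise λ n → ℚ.+-assoc (seq x n) (seq y n) (seq z n)
                }
              ; identity = (λ x → pointwise λ n → ℚ.+-identityˡ (seq x n))
                         , (λ x → pointwise λ n → ℚ.+-identityʳ (seq x n))
              }
            ; inverse = (λ x → pointwise λ n → ℚ.+-inverseˡ (seq x n))
                      , (λ x → pointwise λ n → ℚ.+-inverseʳ (seq x n))
            ; ⁻¹-cong = -‿cong
            }
          ; comm = λ x y → pointwise λ n → ℚ.+-comm (seq x n) (seq y n)
          }
        ; *-cong = *-cong
        ; *-assoc = λ x y z → pointwise λ n → ℚ.*-assoc (seq x n) (seq y n) (seq z n)
        ; *-identity = (λ x → pointwise λ n → ℚ.*-identityˡ (seq x n))
                     , (λ x → pointwise λ n → ℚ.*-identityʳ (seq x n))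
        ; distrib = (λ x y z → pointwise λ n → ℚ.*-distribˡ-+ (seq x n) (seq y n) (seq z n))
                  , (λ x y z → pointwise λ n → ℚ.*-distribʳ-+ (seq x n) (seq y n) (seq z n))
        }
      ; *-comm = λ x y → pointwise λ n → ℚ.*-comm (seq x n) (seq y n)
      }
    }

module ℚ-identities where

  open import Data.Rational.Base using (_+_; _*_; _-_)
  open ℚ-Solver.+-*-Solver

  *-assoc-re : ∀ a b c d e f →
      (a * c - b * d) * e - (a * d + b * c) * f ≡ a * (c * e - d * f) - b * (c * f + d * e)
  *-assoc-re =
    solve 6 (λ a b c d e f → (a :* c :- b :* d) :* e :- (a :* d :+ b :* c) :* f
                          := a :* (c :* e :- d :* f) :- b :* (c :* f :+ d :* e)) refl

  *-assoc-im : ∀ a b c d e f →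
      (a * c - b * d) * f + (a * d + b * c) * e ≡ a * (c * f + d * e) + b * (c * e - d * f)
  *-assoc-im =
    solve 6 (λ a b c d e f → (a :* c :- b :* d) :* f :+ (a :* d :+ b :* c) :* e
                          := a :* (c :* f :+ d :* e) :+ b :* (c :* e :- d :* f)) refl

  *-comm-re : ∀ a b c d → a * c - b * d ≡ c * a - d * b
  *-comm-re = solve 4 (λ a b c d → a :* c :- b :* d := c :* a :- d :* b) refl

  *-comm-im : ∀ a b c d → a * d + b * c ≡ c * b + d * a
  *-comm-im = solve 4 (λ a b c d → a :* d :+ b :* c := c :* b :+ d :* a) refl

  distribˡ-re : ∀ a b c d e f → a * (c + e) - b * (d + f) ≡ (a * c - b * d) + (a * e - b * f)
  distribˡ-re =
    solve 6 (λ a b c d e f → a :* (c :+ e) :- b :* (d :+ f)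
                          := (a :* c :- b :* d) :+ (a :* e :- b :* f)) refl

  distribˡ-im : ∀ a b c d e f → a * (d + f) + b * (c + e) ≡ (a * d + b * c) + (a * f + b * e)
  distribˡ-im =
    solve 6 (λ a b c d e f → a :* (d :+ f) :+ b :* (c :+ e)
                          := (a :* d :+ b :* c) :+ (a :* f :+ b :* e)) refl

  distribʳ-re : ∀ a b c d e f → (c + e) * a - (d + f) * b ≡ (c * a - d * b) + (e * a - f * b)
  distribʳ-re =
    solve 6 (λ a b c d e f → (c :+ e) :* a :- (d :+ f) :* b
                          := (c :* a :- d :* b) :+ (e :* a :- f :* b)) refl

  distribʳ-im : ∀ a b c d e f → (c + e) * b + (d + f) * a ≡ (c * b + d * a) + (e * b + f * a)
  distribʳ-im =
    solve 6 (λ a b c d e f → (c :+ e) :* b :+ (d :+ f) :* a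
                          := (c :* b :+ d :* a) :+ (e :* b :+ f :* a)) refl

  identityˡ-re : ∀ a b → 1ℚ * a - 0ℚ * b ≡ a
  identityˡ-re = solve 2 (λ a b → con 1ℚ :* a :- con 0ℚ :* b := a) refl

  identityˡ-im : ∀ a b → 1ℚ * b + 0ℚ * a ≡ b
  identityˡ-im = solve 2 (λ a b → con 1ℚ :* b :+ con 0ℚ :* a := b) refl

  identityʳ-re : ∀ a b → a * 1ℚ - b * 0ℚ ≡ a
  identityʳ-re = solve 2 (λ a b → a :* con 1ℚ :- b :* con 0ℚ := a) refl

  identityʳ-im : ∀ a b → a * 0ℚ + b * 1ℚ ≡ b
  identityʳ-im = solve 2 (λ a b → a :* con 0ℚ :+ b :* con 1ℚ := b) refl

module Complex where

  open Real
  open CommutativeRing ℝ-commutativeRing using (_-_; 0#; 1#; +-cong; +-assoc; +-comm; +-identityˡ; +-identityʳ; *-cong; -‿cong; -‿inverseˡ; -‿inverseʳ)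
    renaming (refl to ≃-refl; sym to ≃-sym; trans to ≃-trans)

  record ℂ : Set where
    constructor _+i_
    field
      re im : ℝ

  open ℂ public

  infix 4 _≋_

  record _≋_ (z w : ℂ) : Set where
    constructor _,_
    field
      re-≃ : re z ≃ re w
      im-≃ : im z ≃ im w

  private
    *-assoc-re : ∀ a b c d e f →
      (a * c - b * d) * e - (a * d + b * c) * f ≃ a * (c * e - d * f) - b * (c * f + d * e)
    *-assoc-re a b c d e f = pointwise λ n →
      ℚ-identities.*-assoc-re (seq a n) (seq b n) (seq c n) (seq d n) (seq e n) (seq f n)

    *-assoc-im : ∀ a b c d e f →
      (a * c - b * d) * f + (a * d + b * c) * e ≃ a * (c * f + d * e) + b * (c * e - d * f)
    *-assoc-im a b c d e f = pointwise λ n →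
      ℚ-identities.*-assoc-im (seq a n) (seq b n) (seq c n) (seq d n) (seq e n) (seq f n)

    *-comm-re : ∀ a b c d → a * c - b * d ≃ c * a - d * b
    *-comm-re a b c d = pointwise λ n →
      ℚ-identities.*-comm-re (seq a n) (seq b n) (seq c n) (seq d n)

    *-comm-im : ∀ a b c d → a * d + b * c ≃ c * b + d * a
    *-comm-im a b c d = pointwise λ n →
      ℚ-identities.*-comm-im (seq a n) (seq b n) (seq c n) (seq d n)

    distribˡ-re : ∀ a b c d e f → a * (c + e) - b * (d + f) ≃ (a * c - b * d) + (a * e - b * f)
    distribˡ-re a b c d e f = pointwise λ n →
      ℚ-identities.distribˡ-re (seq a n) (seq b n) (seq c n) (seq d n) (seq e n) (seq f n)

    distribˡ-im : ∀ a b c d e f → a * (d + f) + b * (c + e) ≃ (a * d + b * c) + (a * f + b * e)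
    distribˡ-im a b c d e f = pointwise λ n →
      ℚ-identities.distribˡ-im (seq a n) (seq b n) (seq c n) (seq d n) (seq e n) (seq f n)

    distribʳ-re : ∀ a b c d e f → (c + e) * a - (d + f) * b ≃ (c * a - d * b) + (e * a - f * b)
    distribʳ-re a b c d e f = pointwise λ n →
      ℚ-identities.distribʳ-re (seq a n) (seq b n) (seq c n) (seq d n) (seq e n) (seq f n)

    distribʳ-im : ∀ a b c d e f → (c + e) * b + (d + f) * a ≃ (c * b + d * a) + (e * b + f * a)
    distribʳ-im a b c d e f = pointwise λ n →
      ℚ-identities.distribʳ-im (seq a n) (seq b n) (seq c n) (seq d n) (seq e n) (seq f n)

    identityˡ-re : ∀ a b → 1# * a - 0# * b ≃ a
    identityˡ-re a b = pointwise λ n →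
      ℚ-identities.identityˡ-re (seq a n) (seq b n)

    identityˡ-im : ∀ a b → 1# * b + 0# * a ≃ b
    identityˡ-im a b = pointwise λ n →
      ℚ-identities.identityˡ-im (seq a n) (seq b n)

    identityʳ-re : ∀ a b → a * 1# - b * 0# ≃ a
    identityʳ-re a b = pointwise λ n →
      ℚ-identities.identityʳ-re (seq a n) (seq b n)

    identityʳ-im : ∀ a b → a * 0# + b * 1# ≃ b
    identityʳ-im a b = pointwise λ n →
      ℚ-identities.identityʳ-im (seq a n) (seq b n)

  ℂ-commutativeRing : CommutativeRing 0ℓ 0ℓ
  ℂ-commutativeRing = record
    { Carrier = ℂ
    ; _≈_ = _≋_
    ; _+_ = λ z w → (re z + re w) +i (im z + im w)
    ; _*_ = λ z w → (re z * re w - im z * im w) +i (re z * im w + im z * re w)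
    ; -_  = λ z → (- re z) +i (- im z)
    ; 0#  = 0# +i 0#
    ; 1#  = 1# +i 0#
    ; isCommutativeRing = record
      { isRing = record
        { +-isAbelianGroup = record
          { isGroup = record
            { isMonoid = record
              { isSemigroup = record
                { isMagma = record
                  { isEquivalence = record
                    { refl = ≃-refl , ≃-refl
                    ; sym = λ (p , q) → ≃-sym p , ≃-sym q
                    ; trans = λ (p , q) (r , s) → ≃-trans p r , ≃-trans q s
                    }
                  ; ∙-cong = λ (p , q) (r , s) → +-cong p r , +-cong q s
                  }
                ; assoc = λ z w v → +-assoc _ _ _ , +-assoc _ _ _
                }
              ; identity = (λ z → +-identityˡ _ , +-identityˡ _) , (λ z → +-identityʳ _ , +-identityʳ _)
              }
            ; inverse = (λ z → -‿inverseˡ _ , -‿inverseˡ _) , (λ z → -‿inverseʳ _ , -‿inverseʳ _)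
            ; ⁻¹-cong = λ (p , q) → -‿cong p , -‿cong q
            }
          ; comm = λ z w → +-comm _ _ , +-comm _ _
          }
        ; *-cong = λ (p , q) (r , s) →
            +-cong (*-cong p r) (-‿cong (*-cong q s)) , +-cong (*-cong p s) (*-cong q r)
        ; *-assoc = λ (a +i b) (c +i d) (e +i f) → *-assoc-re a b c d e f , *-assoc-im a b c d e f
        ; *-identity = (λ (a +i b) → identityˡ-re a b , identityˡ-im a b)
                     , (λ (a +i b) → identityʳ-re a b , identityʳ-im a b)
        ; distrib = (λ (a +i b) (c +i d) (e +i f) → distribˡ-re a b c d e f , distribˡ-im a b c d e f)
                  , (λ (a +i b) (c +i d) (e +i f) → distribʳ-re a b c d e f , distribʳ-im a b c d e f)
        }
      ; *-comm = λ (a +i b) (c +i d) → *-comm-re a b c d , *-comm-im a b c d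
      }
    }

open Complex public using (ℂ-commutativeRing)

module Integers (R : CommutativeRing 0ℓ 0ℓ) where

  open CommutativeRing R renaming (Carrier to A)
  open RawSemiringDefs (Semiring.rawSemiring semiring) using () renaming (_×_ to _·_)

  fromℤ : ℤ → A
  fromℤ (ℤ.+ n)    = n · 1#
  fromℤ ℤ.-[1+ n ] = - (suc n · 1#)

  IsInteger : A → Set
  IsInteger r = ∃ λ k → r ≈ fromℤ k

-- The free associative R-algebra on X. A polynomial is a formal sum of terms
-- r · w, and two formal sums are identified when all coefficients agree.

module NonCommutativePolynomial (R : CommutativeRing 0ℓ 0ℓ) where

  open CommutativeRing R using (_≈_; 0#; 1#) renaming (Carrier to A; _+_ to _+ᴿ_; _*_ to _*ᴿ_; -_ to -ᴿ_)

  Poly : Set → Set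
  Poly X = List (A × List X)

  module _ {X : Set} where

    infixl 6 _+_ _-_
    infixl 7 _*_
    infixr 7 _•_
    infixr 8 _^_

    constant : A → Poly X
    constant r = [ r , [] ]

    var : X → Poly X
    var x = [ 1# , [ x ] ]

    _+_ : Poly X → Poly X → Poly X
    _+_ = _++_

    _•_ : A → Poly X → Poly X
    r • p = map (λ (s , w) → (r *ᴿ s) , w) p

    _-_ : Poly X → Poly X → Poly X
    p - q = p + (-ᴿ 1#) • q

    _*_ : Poly X → Poly X → Poly X
    _*_ = cartesianProductWith λ (r , v) (s , w) → (r *ᴿ s) , (v ++ w)

    _^_ : Poly X → ℕ → Poly X
    p ^ zero  = constant 1#
    p ^ suc n = p * p ^ n

    ∑ : List (Poly X) → Poly X
    ∑ = foldr _+_ []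

  substitute : {X Y : Set} → (X → Poly Y) → Poly X → Poly Y
  substitute f p = ∑ (map (λ (r , w) → r • foldr (λ x q → f x * q) (constant 1#) w) p)

  module Coefficients {X : Set} (_≟_ : DecidableEquality X) where

    coefficient : Poly X → List X → A
    coefficient p w =
      foldr _+ᴿ_ 0# (map (λ (r , v) → if does (≡-dec _≟_ v w) then r else 0#) p)

    infix 4 _≈ᴾ_

    _≈ᴾ_ : Poly X → Poly X → Set
    p ≈ᴾ q = ∀ w → coefficient p w ≈ coefficient q w

    IntegerCoefficients : Poly X → Set
    IntegerCoefficients p = ∀ w → Integers.IsInteger R (coefficient p w)

data AB : Set where
  𝐚 𝐛 : AB

data CD : Set where
  𝐜 𝐝 : CD

_≟ᴬᴮ_ : DecidableEquality AB
𝐚 ≟ᴬᴮ 𝐚 = yes refl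
𝐚 ≟ᴬᴮ 𝐛 = no λ ()
𝐛 ≟ᴬᴮ 𝐚 = no λ ()
𝐛 ≟ᴬᴮ 𝐛 = yes refl

_≟ᶜᴰ_ : DecidableEquality CD
𝐜 ≟ᶜᴰ 𝐜 = yes refl
𝐜 ≟ᶜᴰ 𝐝 = no λ ()
𝐝 ≟ᶜᴰ 𝐜 = no λ ()
𝐝 ≟ᶜᴰ 𝐝 = yes refl

module QuasiGraded (R : CommutativeRing 0ℓ 0ℓ) where

  open CommutativeRing R using (_≈_; 0#; 1#; -_; semiring)
    renaming (Carrier to A; _+_ to _+ᴿ_; _*_ to _*ᴿ_)
  open RawSemiringDefs (Semiring.rawSemiring semiring) using () renaming (_^_ to _^ᴿ_)
  open NonCommutativePolynomial R

  sumᴿ : List A → A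
  sumᴿ = foldr _+ᴿ_ 0#

  record QuasiGradedPoset : Set₁ where
    infix 4 _≤_
    field
      Carrier           : Set
      _≤_               : Rel Carrier 0ℓ
      isDecPartialOrder : IsDecPartialOrder _≡_ _≤_
      size              : ℕ
      finite            : Fin size ↔ Carrier

    open IsDecPartialOrder isDecPartialOrder public using (_≟_; _≤?_)
    open ToStrict _≡_ _≤_ public using (_<_)

    _<?_ : ∀ x y → Dec (x < y)
    _<?_ = ToStrict.<-decidable _≡_ _≤_ _≟_ _≤?_

    field
      ρ      : Carrier → ℕ
      ρ-mono : ∀ {x y} → x < y → ρ x ℕ.< ρ y
      -- An element of the incidence algebra, extended by zero to pairs x ≰ y.
      ζ̄         : Carrier → Carrier → A
      ζ̄-support : ∀ {x y} → ¬ x ≤ y → ζ̄ x y ≈ 0#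
      ζ̄-diag    : ∀ x → ζ̄ x x ≈ 1#

    elements : List Carrier
    elements = map (Inverse.to finite) (allFin size)

    -- Truncated subtraction, used only for x ≤ y, where ρ x ≤ ρ y.
    ρ[_,_] : Carrier → Carrier → ℕ
    ρ[ x , y ] = ρ y ∸ ρ x

    interval : Carrier → Carrier → List Carrier
    interval x z = filter (λ y → (x ≤? y) ×-dec (y ≤? z)) elements

    δ : Carrier → Carrier → A
    δ x z = if does (x ≟ z) then 1# else 0#

    Eulerian : Set
    Eulerian = ∀ x z → x ≤ z →
      sumᴿ (map (λ y → (- 1#) ^ᴿ ρ[ x , y ] *ᴿ (ζ̄ x y *ᴿ ζ̄ y z)) (interval x z)) ≈ δ x z

    IntegerValued : Set
    IntegerValued = ∀ x y → Integers.IsInteger R (ζ̄ x y)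

    -- All chains x = x₀ < x₁ < ⋯ < x_k = y, as lists x₀ ∷ x₁ ∷ ⋯ ∷ x_k ∷ [].
    chainsOfLength : ℕ → Carrier → Carrier → List (List Carrier)
    chainsOfLength zero    x y = if does (x ≟ y) then [ [ x ] ] else []
    chainsOfLength (suc k) x y =
      concatMap (λ z → map (x ∷_) (chainsOfLength k z y)) (filter (x <?_) elements)

    -- A chain has at most size elements, so k ranges over 1, …, size.
    chains : Carrier → Carrier → List (List Carrier)
    chains x y = concatMap (λ k → chainsOfLength (suc k) x y) (upTo size)

    ζ̄-product : List Carrier → A
    ζ̄-product (x ∷ y ∷ c) = ζ̄ x y *ᴿ ζ̄-product (y ∷ c)
    ζ̄-product _           = 1#

    a-b : Poly AB
    a-b = var 𝐚 - var 𝐛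

    -- (𝐚-𝐛)^{ρ(x₀,x₁)-1} 𝐛 (𝐚-𝐛)^{ρ(x₁,x₂)-1} 𝐛 ⋯ 𝐛 (𝐚-𝐛)^{ρ(x_{k-1},x_k)-1};
    -- the last clause is never used, since k ≥ 1.
    weight : List Carrier → Poly AB
    weight (x ∷ y ∷ [])        = a-b ^ (ρ[ x , y ] ∸ 1)
    weight (x ∷ c@(y ∷ _ ∷ _)) = a-b ^ (ρ[ x , y ] ∸ 1) * var 𝐛 * weight c
    weight _                   = constant 1#

    ab-index : Carrier → Carrier → Poly AB
    ab-index 0̂ 1̂ = ∑ (map (λ c → ζ̄-product c • weight c) (chains 0̂ 1̂))

  open NonCommutativePolynomial.Coefficients R _≟ᴬᴮ_ renaming (_≈ᴾ_ to _≈ᴬᴮ_) using () public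
  open NonCommutativePolynomial.Coefficients R _≟ᶜᴰ_ renaming (_≈ᴾ_ to _≈ᶜᴰ_)
    using (IntegerCoefficients) public

  cd-letter : CD → Poly AB
  cd-letter 𝐜 = var 𝐚 + var 𝐛
  cd-letter 𝐝 = var 𝐚 * var 𝐛 + var 𝐛 * var 𝐚

  expand : Poly CD → Poly AB
  expand = substitute cd-letter

{-# OPTIONS --safe #-}
module Submission where

-- Encode a polynomial by its coefficient function, on which left multiplication by a fixed
-- polynomial is a linear operator. With e = a - b, let G(x,y) = ζ̄(x,y) e^(ρ(x,y)-1) for x < y and
-- G̃(x,y) = (-1)^ρ(x,y) G(x,y). Splitting off the first step of a chain gives Ψ = G φ, where
-- φ = δ + b Ψ, and the Eulerian condition says G + G̃ + G̃ e G = 0. Applying the latter to φ gives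
-- Ψ = - G̃ (φ + e Ψ), and adding both expressions
--   2 Ψ(x) = Σ_z [G(x,z) φ(z) - G̃(x,z) (φ(z) + e Ψ(z))].
-- A summand with ρ(x,z) odd is ζ̄ e^(ρ-1) (2δ + c Ψ(z)), one with ρ(x,z) even is - ζ̄ e^ρ Ψ(z); as
-- e² = c² - 2d, induction on x shows that Ψ(x) is a polynomial in c and d.
-- Conversely the coefficients of g and h are differences of coefficients of c g + d h, so the
-- coefficients of a cd-polynomial are integral combinations of those of its expansion: this gives
-- both uniqueness and integrality.

open import Defs
open import Level using (0ℓ)
open import Algebra.Bundles using (CommutativeRing; Semiring)
import Algebra.Definitions.RawSemiring as RawSemiringDefs
import Algebra.Properties.Ring as RingProperties
import Algebra.Properties.Semiring.Mult as SemiringMult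
import Algebra.Solver.Ring as RingSolver
open import Algebra.Solver.Ring.AlmostCommutativeRing using (fromCommutativeRing; _-Raw-AlmostCommutative⟶_)
open import Data.Bool.Base using (true; false; if_then_else_)
open import Data.Integer.Base as ℤ using (ℤ; _⊖_)
import Data.Integer.Properties as ℤ
open import Data.List.Base using (List; []; _∷_; [_]; _++_; map; foldr; filter; concatMap; allFin; applyUpTo; upTo; length)
open import Data.List.Properties using (≡-dec; length-filter; length-map; length-tabulate; map-upTo; upTo-∷ʳ)
open import Data.List.Membership.Propositional using (_∈_)
open import Data.List.Membership.Propositional.Properties using (∈-allFin; ∈-map⁺)
open import Data.List.Relation.Unary.All as All using (All; []; _∷_)
import Data.List.Relation.Unary.All.Properties as All
open import Data.List.Relation.Unary.Any using (here; there)
open import Data.List.Relation.Unary.AllPairs using (_∷_)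
open import Data.List.Relation.Unary.Unique.Propositional using (Unique)
open import Data.List.Relation.Unary.Unique.Propositional.Properties using (allFin⁺; map⁺)
import Data.Maybe.Base as Maybe
open Maybe using (Maybe)
open import Data.Nat.Base as ℕ using (ℕ; zero; suc; _∸_)
import Data.Nat.Properties as ℕ
open import Data.Product using (_×_; ∃!; ∃; _,_; proj₁; proj₂)
open import Data.Rational.Base using (½; 0ℚ)
open import Data.Sum.Base using (_⊎_; inj₁; inj₂)
open import Function.Base using (case_of_)
open import Function.Bundles using (Inverse; Injection)
open import Function.Properties.Inverse using (↔⇒↣)
open import Relation.Binary.Definitions using (Minimum; Maximum; DecidableEquality)
open import Relation.Binary.Structures using (IsDecPartialOrder)
import Relation.Binary.Construct.NonStrictToStrict as ToStrict
open import Relation.Binary.PropositionalEquality as ≡ using (_≡_)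
open import Relation.Nullary using (¬_; Dec; yes; no; does; contradiction)
open import Relation.Nullary.Decidable using (dec⇒maybe; dec-true; dec-false; _×-dec_)
open import Relation.Unary using (Pred; Decidable)

-- Integers in a commutative ring, and a ring solver with integer coefficients.

module IntegerHomomorphism (R : CommutativeRing 0ℓ 0ℓ) where

  open CommutativeRing R
  open RingProperties ring
  open SemiringMult semiring using (×-homo-+; ×1-homo-*) renaming (_×_ to _·_)
  open Integers R
  open import Relation.Binary.Reasoning.Setoid setoid

  -- Induction on both arguments: a common successor cancels in `⊖`, which the ring side matches by
  -- inserting `1# - 1#`.
  fromℤ-⊖ : ∀ m n → fromℤ (m ⊖ n) ≈ m · 1# - n · 1#
  fromℤ-⊖ zero    zero    = sym (-‿inverseʳ 0#)
  fromℤ-⊖ (suc m) zero    = sym (trans (+-congˡ -0#≈0#) (+-identityʳ _))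
  fromℤ-⊖ zero    (suc n) = sym (+-identityˡ _)
  fromℤ-⊖ (suc m) (suc n) = begin
    fromℤ (suc m ⊖ suc n)               ≡⟨ ≡.cong fromℤ (ℤ.[1+m]⊖[1+n]≡m⊖n m n) ⟩
    fromℤ (m ⊖ n)                       ≈⟨ fromℤ-⊖ m n ⟩
    m · 1# - n · 1#                     ≈⟨ +-congʳ (+-identityʳ _) ⟨
    (m · 1# + 0#) - n · 1#              ≈⟨ +-congʳ (+-congˡ (-‿inverseʳ 1#)) ⟨
    (m · 1# + (1# - 1#)) - n · 1#       ≈⟨ +-congʳ (+-assoc _ _ _) ⟨
    ((m · 1# + 1#) - 1#) - n · 1#       ≈⟨ +-assoc _ _ _ ⟩
    (m · 1# + 1#) + (- 1# - n · 1#)     ≈⟨ +-cong (+-comm _ _) (-‿+-comm _ _) ⟩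
    suc m · 1# - suc n · 1#             ∎

  fromℤ-homo-neg : ∀ i → fromℤ (ℤ.- i) ≈ - fromℤ i
  fromℤ-homo-neg (ℤ.+ zero)    = sym -0#≈0#
  fromℤ-homo-neg (ℤ.+ (suc n)) = refl
  fromℤ-homo-neg ℤ.-[1+ n ]    = sym (-‿involutive _)

  fromℤ-homo-+ : ∀ i j → fromℤ (i ℤ.+ j) ≈ fromℤ i + fromℤ j
  fromℤ-homo-+ (ℤ.+ m)    (ℤ.+ n)    = ×-homo-+ 1# m n
  fromℤ-homo-+ (ℤ.+ m)    ℤ.-[1+ n ] = fromℤ-⊖ m (suc n)
  fromℤ-homo-+ ℤ.-[1+ m ] (ℤ.+ n)    = trans (fromℤ-⊖ n (suc m)) (+-comm _ _)
  fromℤ-homo-+ ℤ.-[1+ m ] ℤ.-[1+ n ] = begin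
    - (suc (suc (m ℕ.+ n)) · 1#)        ≡⟨ ≡.cong (λ k → - (suc k · 1#)) (ℕ.+-suc m n) ⟨
    - ((suc m ℕ.+ suc n) · 1#)          ≈⟨ -‿cong (×-homo-+ 1# (suc m) (suc n)) ⟩
    - (suc m · 1# + suc n · 1#)         ≈⟨ -‿+-comm _ _ ⟨
    - (suc m · 1#) - suc n · 1#         ∎

  private
    fromℤ-homo-+* : ∀ m j → fromℤ (ℤ.+ m ℤ.* j) ≈ fromℤ (ℤ.+ m) * fromℤ j
    fromℤ-homo-+* m (ℤ.+ n) = begin
      fromℤ (ℤ.+ m ℤ.* ℤ.+ n)        ≡⟨ ≡.cong fromℤ (ℤ.pos-* m n) ⟨
      (m ℕ.* n) · 1#                 ≈⟨ ×1-homo-* m n ⟩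
      (m · 1#) * (n · 1#)            ∎
    fromℤ-homo-+* m ℤ.-[1+ n ] = begin
      fromℤ (ℤ.+ m ℤ.* ℤ.-[1+ n ])         ≡⟨ ≡.cong fromℤ (ℤ.neg-distribʳ-* (ℤ.+ m) (ℤ.+ suc n)) ⟨
      fromℤ (ℤ.- (ℤ.+ m ℤ.* ℤ.+ suc n))    ≈⟨ fromℤ-homo-neg (ℤ.+ m ℤ.* ℤ.+ suc n) ⟩
      - fromℤ (ℤ.+ m ℤ.* ℤ.+ suc n)        ≈⟨ -‿cong (fromℤ-homo-+* m (ℤ.+ suc n)) ⟩
      - ((m · 1#) * (suc n · 1#))          ≈⟨ -‿distribʳ-* _ _ ⟩
      (m · 1#) * - (suc n · 1#)            ∎

  fromℤ-homo-* : ∀ i j → fromℤ (i ℤ.* j) ≈ fromℤ i * fromℤ j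
  fromℤ-homo-* (ℤ.+ m)    j = fromℤ-homo-+* m j
  fromℤ-homo-* ℤ.-[1+ m ] j = begin
    fromℤ (ℤ.-[1+ m ] ℤ.* j)           ≡⟨ ≡.cong fromℤ (ℤ.neg-distribˡ-* (ℤ.+ suc m) j) ⟨
    fromℤ (ℤ.- (ℤ.+ suc m ℤ.* j))      ≈⟨ fromℤ-homo-neg (ℤ.+ suc m ℤ.* j) ⟩
    - fromℤ (ℤ.+ suc m ℤ.* j)          ≈⟨ -‿cong (fromℤ-homo-+* (suc m) j) ⟩
    - ((suc m · 1#) * fromℤ j)         ≈⟨ -‿distribˡ-* _ _ ⟩
    - (suc m · 1#) * fromℤ j           ∎

  IsInteger-resp-≈ : ∀ {r s} → r ≈ s → IsInteger r → IsInteger s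
  IsInteger-resp-≈ r≈s (k , r≈k) = k , trans (sym r≈s) r≈k

  0#-isInteger : IsInteger 0#
  0#-isInteger = ℤ.0ℤ , refl

  1#-isInteger : IsInteger 1#
  1#-isInteger = ℤ.1ℤ , sym (+-identityʳ 1#)

  +-isInteger : ∀ {r s} → IsInteger r → IsInteger s → IsInteger (r + s)
  +-isInteger (i , r≈i) (j , s≈j) = i ℤ.+ j , trans (+-cong r≈i s≈j) (sym (fromℤ-homo-+ i j))

  *-isInteger : ∀ {r s} → IsInteger r → IsInteger s → IsInteger (r * s)
  *-isInteger (i , r≈i) (j , s≈j) = i ℤ.* j , trans (*-cong r≈i s≈j) (sym (fromℤ-homo-* i j))

  neg-isInteger : ∀ {r} → IsInteger r → IsInteger (- r)
  neg-isInteger (i , r≈i) = ℤ.- i , trans (-‿cong r≈i) (sym (fromℤ-homo-neg i))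

  private
    -- The solver has to compare coefficients, and equality in `R` need not be decidable. Integer
    -- coefficients, interpreted through `fromℤ`, can be compared.
    fromℤ-morphism : ℤ.+-*-rawRing -Raw-AlmostCommutative⟶ fromCommutativeRing R
    fromℤ-morphism = record
      { ⟦_⟧    = fromℤ
      ; +-homo = fromℤ-homo-+
      ; *-homo = fromℤ-homo-*
      ; -‿homo = fromℤ-homo-neg
      ; 0-homo = refl
      ; 1-homo = +-identityʳ 1#
      }

    fromℤ-≈? : ∀ i j → Maybe (fromℤ i ≈ fromℤ j)
    fromℤ-≈? i j = Maybe.map (λ i≡j → reflexive (≡.cong fromℤ i≡j)) (dec⇒maybe (i ℤ.≟ j))

  open RingSolver ℤ.+-*-rawRing (fromCommutativeRing R) fromℤ-morphism fromℤ-≈? public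
    using (solve; _:=_; _:+_; _:*_; :-_; _:-_; con)

-- Finite sums over lists.

module Sums (R : CommutativeRing 0ℓ 0ℓ) where

  open CommutativeRing R renaming (Carrier to A)
  open Integers R
  open IntegerHomomorphism R
  open import Relation.Binary.Reasoning.Setoid setoid

  private variable
    I J : Set

  ∑ : List I → (I → A) → A
  ∑ xs f = foldr _+_ 0# (map f xs)

  infix 5 ∑
  syntax ∑ xs (λ x → e) = ∑[ x ← xs ] e

  ∑-cong-All : ∀ {xs : List I} {f g : I → A} → All (λ x → f x ≈ g x) xs → ∑ xs f ≈ ∑ xs g
  ∑-cong-All []       = refl
  ∑-cong-All (p ∷ ps) = +-cong p (∑-cong-All ps)

  ∑-cong : ∀ (xs : List I) {f g : I → A} → (∀ x → f x ≈ g x) → ∑ xs f ≈ ∑ xs g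
  ∑-cong xs f≈g = ∑-cong-All (All.universal f≈g xs)

  ∑-zero : ∀ (xs : List I) {f : I → A} → (∀ x → f x ≈ 0#) → ∑ xs f ≈ 0#
  ∑-zero []       f≈0 = refl
  ∑-zero (x ∷ xs) f≈0 = trans (+-cong (f≈0 x) (∑-zero xs f≈0)) (+-identityˡ 0#)

  ∑-+ : ∀ (xs : List I) (f g : I → A) → ∑[ x ← xs ] (f x + g x) ≈ ∑ xs f + ∑ xs g
  ∑-+ []       f g = sym (+-identityˡ 0#)
  ∑-+ (x ∷ xs) f g = trans (+-congˡ (∑-+ xs f g))
    (solve 4 (λ a b c d → (a :+ b) :+ (c :+ d) := (a :+ c) :+ (b :+ d)) refl (f x) (g x) (∑ xs f) (∑ xs g))

  ∑-*ˡ : ∀ (xs : List I) a (f : I → A) → ∑[ x ← xs ] (a * f x) ≈ a * ∑ xs f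
  ∑-*ˡ []       a f = sym (zeroʳ a)
  ∑-*ˡ (x ∷ xs) a f = trans (+-congˡ (∑-*ˡ xs a f)) (sym (distribˡ a (f x) (∑ xs f)))

  ∑-*ʳ : ∀ (xs : List I) a (f : I → A) → ∑[ x ← xs ] (f x * a) ≈ ∑ xs f * a
  ∑-*ʳ xs a f = trans (∑-cong xs λ x → *-comm (f x) a) (trans (∑-*ˡ xs a f) (*-comm a (∑ xs f)))

  ∑-neg : ∀ (xs : List I) (f : I → A) → ∑[ x ← xs ] (- f x) ≈ - ∑ xs f
  ∑-neg []       f = solve 0 (con ℤ.0ℤ := :- con ℤ.0ℤ) refl
  ∑-neg (x ∷ xs) f = trans (+-congˡ (∑-neg xs f))
    (solve 2 (λ a b → :- a :+ :- b := :- (a :+ b)) refl (f x) (∑ xs f))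

  ∑-++ : ∀ (xs ys : List I) (f : I → A) → ∑ (xs ++ ys) f ≈ ∑ xs f + ∑ ys f
  ∑-++ []       ys f = sym (+-identityˡ _)
  ∑-++ (x ∷ xs) ys f = trans (+-congˡ (∑-++ xs ys f)) (sym (+-assoc _ _ _))

  ∑-map : ∀ (h : I → J) (xs : List I) (f : J → A) → ∑ (map h xs) f ≈ ∑[ x ← xs ] f (h x)
  ∑-map h []       f = refl
  ∑-map h (x ∷ xs) f = +-congˡ (∑-map h xs f)

  ∑-concatMap : ∀ (h : I → List J) (xs : List I) (f : J → A) →
                ∑ (concatMap h xs) f ≈ ∑[ x ← xs ] ∑ (h x) f
  ∑-concatMap h []       f = refl
  ∑-concatMap h (x ∷ xs) f = trans (∑-++ (h x) (concatMap h xs) f) (+-congˡ (∑-concatMap h xs f))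

  ∑-filter : ∀ {P : Pred I 0ℓ} (P? : Decidable P) (xs : List I) (f : I → A) →
             ∑ (filter P? xs) f ≈ ∑[ x ← xs ] (if does (P? x) then f x else 0#)
  ∑-filter P? []       f = refl
  ∑-filter P? (x ∷ xs) f with does (P? x)
  ... | true  = +-congˡ (∑-filter P? xs f)
  ... | false = trans (∑-filter P? xs f) (sym (+-identityˡ _))

  ∑-swap : ∀ (xs : List I) (ys : List J) (f : I → J → A) →
           ∑[ x ← xs ] ∑[ y ← ys ] f x y ≈ ∑[ y ← ys ] ∑[ x ← xs ] f x y
  ∑-swap []       ys f = sym (∑-zero ys λ _ → refl)
  ∑-swap (x ∷ xs) ys f = trans (+-congˡ (∑-swap xs ys f)) (sym (∑-+ ys (f x) λ y → ∑[ z ← xs ] f z y))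

  -- Uniqueness of the entries makes `x` occur exactly once, so its term is neither missed nor
  -- repeated.
  ∑-support : ∀ {x : I} {xs} {f : I → A} → Unique xs → x ∈ xs → (∀ y → ¬ x ≡ y → f y ≈ 0#) → ∑ xs f ≈ f x
  ∑-support {x = x} {_ ∷ xs} {f} (x∉xs ∷ uxs) (here ≡.refl) f≈0 =
    trans (+-congˡ (trans (∑-cong-All (All.map (λ {y} → f≈0 y) x∉xs)) (∑-zero xs λ _ → refl))) (+-identityʳ (f x))
  ∑-support {x = x} {f = f} (y∉xs ∷ uxs) (there x∈xs) f≈0 =
    trans (+-cong (f≈0 _ λ { ≡.refl → All.lookup y∉xs x∈xs ≡.refl }) (∑-support uxs x∈xs f≈0)) (+-identityˡ (f x))

  ∑-isInteger : ∀ (xs : List I) {f : I → A} → (∀ x → IsInteger (f x)) → IsInteger (∑ xs f)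
  ∑-isInteger []       int = 0#-isInteger
  ∑-isInteger (x ∷ xs) int = +-isInteger (int x) (∑-isInteger xs int)

  ∑-upTo-suc : ∀ n (f : ℕ → A) → ∑ (upTo (suc n)) f ≈ ∑ (upTo n) f + f n
  ∑-upTo-suc n f = begin
    ∑ (upTo (suc n)) f           ≡⟨ ≡.cong (λ xs → ∑ xs f) (upTo-∷ʳ n) ⟨
    ∑ (upTo n ++ [ n ]) f        ≈⟨ ∑-++ (upTo n) [ n ] f ⟩
    ∑ (upTo n) f + (f n + 0#)    ≈⟨ +-congˡ (+-identityʳ (f n)) ⟩
    ∑ (upTo n) f + f n           ∎

  -- Splits off the first index where `∑-upTo-suc` splits off the last one; reading one sum both
  -- ways yields the recursion on chain lengths.
  ∑-upTo-shift : ∀ n (f : ℕ → A) → ∑ (upTo (suc n)) f ≈ f 0 + (∑[ k ← upTo n ] f (suc k))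
  ∑-upTo-shift n f = +-congˡ (begin
    ∑ (applyUpTo suc n) f         ≡⟨ ≡.cong (λ xs → ∑ xs f) (map-upTo suc n) ⟨
    ∑ (map suc (upTo n)) f        ≈⟨ ∑-map suc (upTo n) f ⟩
    ∑[ k ← upTo n ] f (suc k)     ∎)

-- Coefficient functions and linear operators on them.

module Series (R : CommutativeRing 0ℓ 0ℓ) where

  open CommutativeRing R renaming (Carrier to A)
  open Sums R
  open import Relation.Binary.Reasoning.Setoid setoid

  -- No finiteness of the support is imposed: these are formal power series in non-commuting
  -- variables.
  Series : Set → Set
  Series X = List X → A

  infix 4 _≐_
  _≐_ : {X : Set} → Series X → Series X → Set
  f ≐ g = ∀ w → f w ≈ g w

  -- Compatibility with `_≐_` is a field, because an arbitrary function on series need not respect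
  -- the pointwise setoid equality.
  record Linear {X Y : Set} (T : Series X → Series Y) : Set where
    field
      cong   : ∀ {f g} → f ≐ g → T f ≐ T g
      +-homo : ∀ f g → T (λ w → f w + g w) ≐ λ w → T f w + T g w
      *-homo : ∀ r f → T (λ w → r * f w) ≐ λ w → r * T f w

    0-homo : ∀ {f} → (∀ w → f w ≈ 0#) → ∀ w → T f w ≈ 0#
    0-homo {f} f≈0 w = begin
      T f w                   ≈⟨ cong (λ v → trans (f≈0 v) (sym (zeroˡ (f v)))) w ⟩
      T (λ v → 0# * f v) w    ≈⟨ *-homo 0# f w ⟩
      0# * T f w              ≈⟨ zeroˡ _ ⟩
      0#                      ∎

    ∑-homo : ∀ {I : Set} (xs : List I) (f : I → Series X) →
             T (λ w → ∑[ x ← xs ] f x w) ≐ λ w → ∑[ x ← xs ] T (f x) w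
    ∑-homo []       f w = 0-homo (λ _ → refl) w
    ∑-homo (x ∷ xs) f w =
      trans (+-homo (f x) (λ v → ∑[ y ← xs ] f y v) w) (+-congˡ (∑-homo xs f w))

  open Linear

  id-linear : ∀ {X} → Linear {X} (λ f → f)
  id-linear = record { cong = λ f≐g → f≐g ; +-homo = λ _ _ _ → refl ; *-homo = λ _ _ _ → refl }

  ∘-linear : ∀ {X Y Z} {T : Series Y → Series Z} {U : Series X → Series Y} →
             Linear T → Linear U → Linear (λ f → T (U f))
  ∘-linear {T = T} {U} T-lin U-lin = record
    { cong   = λ f≐g → cong T-lin (cong U-lin f≐g)
    ; +-homo = λ f g w → trans (cong T-lin (+-homo U-lin f g) w) (+-homo T-lin (U f) (U g) w)
    ; *-homo = λ r f w → trans (cong T-lin (*-homo U-lin r f) w) (*-homo T-lin r (U f) w)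
    }

-- Polynomials acting on series by left multiplication.

module Multiplication (R : CommutativeRing 0ℓ 0ℓ) {X : Set} (_≟_ : DecidableEquality X) where

  open CommutativeRing R renaming (Carrier to A)
  open Sums R
  open Series R
  open Linear
  open NonCommutativePolynomial R using (Poly; _•_)
    renaming (_+_ to _+ᴾ_; _*_ to _*ᴾ_; ∑ to ∑ᴾ)
  open NonCommutativePolynomial.Coefficients R _≟_
  open import Relation.Binary.Reasoning.Setoid setoid

  coefficient-+ : ∀ p q → coefficient (p +ᴾ q) ≐ λ w → coefficient p w + coefficient q w
  coefficient-+ p q w = ∑-++ p q _

  coefficient-• : ∀ r p → coefficient (r • p) ≐ λ w → r * coefficient p w
  coefficient-• r []            w = sym (zeroʳ r)
  coefficient-• r ((s , v) ∷ p) w with does (≡-dec _≟_ v w)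
  ... | true  = trans (+-congˡ (coefficient-• r p w)) (sym (distribˡ r _ _))
  ... | false = trans (+-cong (sym (zeroʳ r)) (coefficient-• r p w)) (sym (distribˡ r _ _))

  coefficient-∑ : ∀ {I : Set} (xs : List I) (f : I → Poly X) →
                  coefficient (∑ᴾ (map f xs)) ≐ λ w → ∑[ x ← xs ] coefficient (f x) w
  coefficient-∑ []       f w = refl
  coefficient-∑ (x ∷ xs) f w =
    trans (coefficient-+ (f x) (∑ᴾ (map f xs)) w) (+-congˡ (coefficient-∑ xs f w))

  -- Left multiplication by the letter `x`: the coefficient of a word that starts with `x` is that
  -- of its tail, and all other coefficients vanish.
  shift : X → Series X → Series X
  shift x s []      = 0#
  shift x s (y ∷ w) = if does (x ≟ y) then s w else 0#

  shifts : List X → Series X → Series X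
  shifts v s = foldr shift s v

  shift-linear : ∀ x → Linear (shift x)
  shift-linear x = record { cong = congˢ ; +-homo = +-homoˢ ; *-homo = *-homoˢ }
    where
    congˢ : ∀ {f g} → f ≐ g → shift x f ≐ shift x g
    congˢ f≐g []      = refl
    congˢ f≐g (y ∷ w) with does (x ≟ y)
    ... | true  = f≐g w
    ... | false = refl
    +-homoˢ : ∀ f g → shift x (λ w → f w + g w) ≐ λ w → shift x f w + shift x g w
    +-homoˢ f g []      = sym (+-identityˡ 0#)
    +-homoˢ f g (y ∷ w) with does (x ≟ y)
    ... | true  = refl
    ... | false = sym (+-identityˡ 0#)
    *-homoˢ : ∀ r f → shift x (λ w → r * f w) ≐ λ w → r * shift x f w
    *-homoˢ r f []      = sym (zeroʳ r)
    *-homoˢ r f (y ∷ w) with does (x ≟ y)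
    ... | true  = refl
    ... | false = sym (zeroʳ r)

  shifts-linear : ∀ v → Linear (shifts v)
  shifts-linear []      = id-linear
  shifts-linear (x ∷ v) = ∘-linear (shift-linear x) (shifts-linear v)

  shifts-++ : ∀ v u s → shifts (v ++ u) s ≐ shifts v (shifts u s)
  shifts-++ []      u s w = refl
  shifts-++ (x ∷ v) u s w = cong (shift-linear x) (shifts-++ v u s) w

  prepend : A × List X → A × List X → A × List X
  prepend (r , v) (s , u) = r * s , v ++ u

  coefficient-prepend : ∀ r v q → coefficient (map (prepend (r , v)) q) ≐ λ w → r * shifts v (coefficient q) w
  coefficient-prepend r []      q w       = coefficient-• r q w
  coefficient-prepend r (x ∷ v) q []      = trans (mismatch q) (sym (zeroʳ r))
    where
    mismatch : ∀ q → coefficient (map (prepend (r , x ∷ v)) q) [] ≈ 0#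
    mismatch []      = refl
    mismatch (t ∷ q) = trans (+-identityˡ _) (mismatch q)
  coefficient-prepend r (x ∷ v) q (y ∷ w) = trans (head q) scale
    where
    head : ∀ q → coefficient (map (prepend (r , x ∷ v)) q) (y ∷ w) ≈
                 (if does (x ≟ y) then coefficient (map (prepend (r , v)) q) w else 0#)
    head [] with does (x ≟ y)
    ... | true  = refl
    ... | false = refl
    -- The boolean of `≡-dec` on two nonempty words is a conjunction over heads and tails, so once
    -- the heads are compared only the tails remain.
    head (t ∷ q) with does (x ≟ y) | head q
    ... | true  | ih = +-congˡ ih
    ... | false | ih = trans (+-identityˡ _) ih
    scale : (if does (x ≟ y) then coefficient (map (prepend (r , v)) q) w else 0#) ≈
            r * (if does (x ≟ y) then shifts v (coefficient q) w else 0#)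
    scale with does (x ≟ y)
    ... | true  = coefficient-prepend r v q w
    ... | false = sym (zeroʳ r)

  -- Left multiplication by `p`, defined on all series; on coefficient functions of polynomials it
  -- is the product, by `coefficient-*`.
  act : Poly X → Series X → Series X
  act p s w = ∑[ t ← p ] (proj₁ t * shifts (proj₂ t) s w)

  act-congʳ : ∀ p {s t} → s ≐ t → act p s ≐ act p t
  act-congʳ p s≐t w = ∑-cong p λ (r , v) → *-congˡ (cong (shifts-linear v) s≐t w)

  coefficient-* : ∀ p q → coefficient (p *ᴾ q) ≐ act p (coefficient q)
  coefficient-* []            q w = refl
  coefficient-* ((r , v) ∷ p) q w =
    trans (coefficient-+ (map (prepend (r , v)) q) (p *ᴾ q) w)
          (+-cong (coefficient-prepend r v q w) (coefficient-* p q w))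

  -- Concatenating words composes their shifts, and linearity of the outer shifts lets them pass
  -- through the sum over `q`. This makes series a module over the free algebra.
  act-* : ∀ p q s → act (p *ᴾ q) s ≐ act p (act q s)
  act-* []            q s w = refl
  act-* ((r , v) ∷ p) q s w =
    trans (∑-++ (map (prepend (r , v)) q) (p *ᴾ q) _) (+-cong act-prepend (act-* p q s w))
    where
    act-prepend : act (map (prepend (r , v)) q) s w ≈ r * shifts v (act q s) w
    act-prepend = begin
      act (map (prepend (r , v)) q) s w
        ≈⟨ ∑-map (prepend (r , v)) q _ ⟩
      ∑[ t ← q ] ((r * proj₁ t) * shifts (v ++ proj₂ t) s w)
        ≈⟨ ∑-cong q (λ (a , u) → trans (*-assoc r a _) (*-congˡ (trans (*-congˡ (shifts-++ v u s w))
             (sym (*-homo (shifts-linear v) a (shifts u s) w))))) ⟩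
      ∑[ t ← q ] (r * shifts v (λ u → proj₁ t * shifts (proj₂ t) s u) w)
        ≈⟨ ∑-*ˡ q r _ ⟩
      r * (∑[ t ← q ] shifts v (λ u → proj₁ t * shifts (proj₂ t) s u) w)
        ≈⟨ *-congˡ (∑-homo (shifts-linear v) q (λ t u → proj₁ t * shifts (proj₂ t) s u) w) ⟨
      r * shifts v (act q s) w ∎

-- Expansion of cd-polynomials, and recovery of their coefficients.

module CDExpansion (R : CommutativeRing 0ℓ 0ℓ) where

  open CommutativeRing R renaming (Carrier to A)
  open Integers R
  open IntegerHomomorphism R
  open Sums R
  open Series R
  open Linear
  open NonCommutativePolynomial R using (Poly; constant; var; _•_)
    renaming (_+_ to _+ᴾ_; _*_ to _*ᴾ_; _-_ to _-ᴾ_; _^_ to _^ᴾ_)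
  open NonCommutativePolynomial.Coefficients R _≟ᴬᴮ_ using (coefficient)
  open NonCommutativePolynomial.Coefficients R _≟ᶜᴰ_ using () renaming (coefficient to coefficientᶜᴰ)
  open Multiplication R _≟ᴬᴮ_
  open QuasiGraded R using (cd-letter; expand)
  open RingProperties ring using (-1*x≈-x)
  open import Relation.Binary.Reasoning.Setoid setoid

  one : Series AB
  one = coefficient (constant 1#)

  one-[] : one [] ≈ 1#
  one-[] = +-identityʳ 1#

  one-∷ : ∀ x w → one (x ∷ w) ≈ 0#
  one-∷ x w = +-identityʳ 0#

  -- Left multiplication by 𝐚-𝐛, by 𝐜 and by 𝐝.

  E C D : Series AB → Series AB
  E s []      = 0#
  E s (𝐚 ∷ w) = s w
  E s (𝐛 ∷ w) = - s w

  C s []      = 0#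
  C s (_ ∷ w) = s w

  D s (𝐚 ∷ 𝐛 ∷ w) = s w
  D s (𝐛 ∷ 𝐚 ∷ w) = s w
  D s _           = 0#

  E^ : ℕ → Series AB → Series AB
  E^ zero    s = s
  E^ (suc n) s = E (E^ n s)

  E-linear : Linear E
  E-linear = record
    { cong   = λ { f≐g [] → refl ; f≐g (𝐚 ∷ w) → f≐g w ; f≐g (𝐛 ∷ w) → -‿cong (f≐g w) }
    ; +-homo = λ { f g [] → sym (+-identityˡ 0#) ; f g (𝐚 ∷ w) → refl
                 ; f g (𝐛 ∷ w) → solve 2 (λ x y → :- (x :+ y) := :- x :+ :- y) refl (f w) (g w) }
    ; *-homo = λ { r f [] → sym (zeroʳ r) ; r f (𝐚 ∷ w) → refl
                 ; r f (𝐛 ∷ w) → solve 2 (λ x y → :- (x :* y) := x :* :- y) refl r (f w) }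
    }

  C-linear : Linear C
  C-linear = record
    { cong   = λ { f≐g [] → refl ; f≐g (_ ∷ w) → f≐g w }
    ; +-homo = λ { f g [] → sym (+-identityˡ 0#) ; f g (_ ∷ w) → refl }
    ; *-homo = λ { r f [] → sym (zeroʳ r) ; r f (_ ∷ w) → refl }
    }

  D-linear : Linear D
  D-linear = record
    { cong   = λ { f≐g [] → refl ; f≐g (𝐚 ∷ []) → refl ; f≐g (𝐛 ∷ []) → refl
                 ; f≐g (𝐚 ∷ 𝐚 ∷ w) → refl ; f≐g (𝐚 ∷ 𝐛 ∷ w) → f≐g w
                 ; f≐g (𝐛 ∷ 𝐚 ∷ w) → f≐g w ; f≐g (𝐛 ∷ 𝐛 ∷ w) → refl }
    ; +-homo = λ { f g [] → 0≈0+0 ; f g (𝐚 ∷ []) → 0≈0+0 ; f g (𝐛 ∷ []) → 0≈0+0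
                 ; f g (𝐚 ∷ 𝐚 ∷ w) → 0≈0+0 ; f g (𝐚 ∷ 𝐛 ∷ w) → refl
                 ; f g (𝐛 ∷ 𝐚 ∷ w) → refl ; f g (𝐛 ∷ 𝐛 ∷ w) → 0≈0+0 }
    ; *-homo = λ { r f [] → sym (zeroʳ r) ; r f (𝐚 ∷ []) → sym (zeroʳ r) ; r f (𝐛 ∷ []) → sym (zeroʳ r)
                 ; r f (𝐚 ∷ 𝐚 ∷ w) → sym (zeroʳ r) ; r f (𝐚 ∷ 𝐛 ∷ w) → refl
                 ; r f (𝐛 ∷ 𝐚 ∷ w) → refl ; r f (𝐛 ∷ 𝐛 ∷ w) → sym (zeroʳ r) }
    }
    where
    0≈0+0 : 0# ≈ 0# + 0#
    0≈0+0 = sym (+-identityˡ 0#)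

  E^-linear : ∀ n → Linear (E^ n)
  E^-linear zero    = id-linear
  E^-linear (suc n) = ∘-linear E-linear (E^-linear n)

  E^-+ : ∀ m n s → E^ m (E^ n s) ≡ E^ (m ℕ.+ n) s
  E^-+ zero    n s = ≡.refl
  E^-+ (suc m) n s = ≡.cong E (E^-+ m n s)

  -- The identity 2𝐛 + (𝐚 - 𝐛) = 𝐜, checked on the first letter of the word.
  2𝐛+E≈C : ∀ s w → shift 𝐛 s w + shift 𝐛 s w + E s w ≈ C s w
  2𝐛+E≈C s []      = solve 0 (con ℤ.0ℤ :+ con ℤ.0ℤ :+ con ℤ.0ℤ := con ℤ.0ℤ) refl
  2𝐛+E≈C s (𝐚 ∷ w) = solve 1 (λ x → con ℤ.0ℤ :+ con ℤ.0ℤ :+ x := x) refl (s w)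
  2𝐛+E≈C s (𝐛 ∷ w) = solve 1 (λ x → x :+ x :+ :- x := x) refl (s w)

  -- In (𝐚 - 𝐛)² the words 𝐚𝐚 and 𝐛𝐛 have sign plus, the words 𝐚𝐛 and 𝐛𝐚 sign minus. All four occur
  -- in 𝐜² with sign plus, and subtracting 2𝐝 flips the mixed ones.
  E²≈C²-2D : ∀ s w → E (E s) w ≈ C (C s) w - (D s w + D s w)
  E²≈C²-2D s []          = solve 0 (con ℤ.0ℤ := con ℤ.0ℤ :- (con ℤ.0ℤ :+ con ℤ.0ℤ)) refl
  E²≈C²-2D s (𝐚 ∷ [])    = solve 0 (con ℤ.0ℤ := con ℤ.0ℤ :- (con ℤ.0ℤ :+ con ℤ.0ℤ)) refl
  E²≈C²-2D s (𝐛 ∷ [])    = solve 0 (:- con ℤ.0ℤ := con ℤ.0ℤ :- (con ℤ.0ℤ :+ con ℤ.0ℤ)) refl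
  E²≈C²-2D s (𝐚 ∷ 𝐚 ∷ w) = solve 1 (λ x → x := x :- (con ℤ.0ℤ :+ con ℤ.0ℤ)) refl (s w)
  E²≈C²-2D s (𝐚 ∷ 𝐛 ∷ w) = solve 1 (λ x → :- x := x :- (x :+ x)) refl (s w)
  E²≈C²-2D s (𝐛 ∷ 𝐚 ∷ w) = solve 1 (λ x → :- x := x :- (x :+ x)) refl (s w)
  E²≈C²-2D s (𝐛 ∷ 𝐛 ∷ w) = solve 1 (λ x → :- :- x := x :- (con ℤ.0ℤ :+ con ℤ.0ℤ)) refl (s w)

  act-var : ∀ x s → act (var x) s ≐ shift x s
  act-var x s w = trans (+-identityʳ _) (*-identityˡ _)

  𝐚-𝐛 : Poly AB
  𝐚-𝐛 = var 𝐚 -ᴾ var 𝐛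

  act-a-b : ∀ s → act 𝐚-𝐛 s ≐ E s
  act-a-b s w = trans (+-cong (*-identityˡ _) (trans (+-identityʳ _)
    (trans (*-congʳ (*-identityʳ _)) (-1*x≈-x _)))) (letters w)
    where
    letters : ∀ w → shift 𝐚 s w - shift 𝐛 s w ≈ E s w
    letters []      = -‿inverseʳ 0#
    letters (𝐚 ∷ w) = solve 1 (λ x → x :- con ℤ.0ℤ := x) refl (s w)
    letters (𝐛 ∷ w) = +-identityˡ _

  act-𝐜 : ∀ s → act (cd-letter 𝐜) s ≐ C s
  act-𝐜 s w = trans (+-cong (*-identityˡ _) (act-var 𝐛 s w)) (letters w)
    where
    letters : ∀ w → shift 𝐚 s w + shift 𝐛 s w ≈ C s w
    letters []      = +-identityˡ 0#
    letters (𝐚 ∷ w) = +-identityʳ _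
    letters (𝐛 ∷ w) = +-identityˡ _

  act-𝐝 : ∀ s → act (cd-letter 𝐝) s ≐ D s
  act-𝐝 s w = trans (+-cong (scale 𝐚 𝐛) (trans (+-identityʳ _) (scale 𝐛 𝐚))) (letters w)
    where
    scale : ∀ x y → (1# * 1#) * shift x (shift y s) w ≈ shift x (shift y s) w
    scale x y = trans (*-congʳ (*-identityˡ 1#)) (*-identityˡ _)
    letters : ∀ w → shift 𝐚 (shift 𝐛 s) w + shift 𝐛 (shift 𝐚 s) w ≈ D s w
    letters []          = +-identityˡ 0#
    letters (𝐚 ∷ [])    = +-identityˡ 0#
    letters (𝐛 ∷ [])    = +-identityˡ 0#
    letters (𝐚 ∷ 𝐚 ∷ w) = +-identityˡ 0#
    letters (𝐚 ∷ 𝐛 ∷ w) = +-identityʳ _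
    letters (𝐛 ∷ 𝐚 ∷ w) = +-identityˡ _
    letters (𝐛 ∷ 𝐛 ∷ w) = +-identityˡ 0#

  act-a-b^ : ∀ n s → act (𝐚-𝐛 ^ᴾ n) s ≐ E^ n s
  act-a-b^ zero    s w = trans (+-identityʳ _) (*-identityˡ _)
  act-a-b^ (suc n) s w = begin
    act (𝐚-𝐛 *ᴾ 𝐚-𝐛 ^ᴾ n) s w           ≈⟨ act-* 𝐚-𝐛 (𝐚-𝐛 ^ᴾ n) s w ⟩
    act 𝐚-𝐛 (act (𝐚-𝐛 ^ᴾ n) s) w        ≈⟨ act-a-b _ w ⟩
    E (act (𝐚-𝐛 ^ᴾ n) s) w                           ≈⟨ cong E-linear (act-a-b^ n s) w ⟩
    E (E^ n s) w                                                  ∎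

  coefficient-a-b^ : ∀ n → coefficient (𝐚-𝐛 ^ᴾ n) ≐ E^ n one
  coefficient-a-b^ zero    w = refl
  coefficient-a-b^ (suc n) w = begin
    coefficient (𝐚-𝐛 *ᴾ 𝐚-𝐛 ^ᴾ n) w     ≈⟨ coefficient-* 𝐚-𝐛 (𝐚-𝐛 ^ᴾ n) w ⟩
    act 𝐚-𝐛 (coefficient (𝐚-𝐛 ^ᴾ n)) w  ≈⟨ act-a-b _ w ⟩
    E (coefficient (𝐚-𝐛 ^ᴾ n)) w                     ≈⟨ cong E-linear (coefficient-a-b^ n) w ⟩
    E (E^ n one) w                                                ∎

  expand-word : List CD → Poly AB
  expand-word = foldr (λ x q → cd-letter x *ᴾ q) (constant 1#)

  letter : CD → Series AB → Series AB
  letter 𝐜 = C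
  letter 𝐝 = D

  letter-linear : ∀ x → Linear (letter x)
  letter-linear 𝐜 = C-linear
  letter-linear 𝐝 = D-linear

  monomial : List CD → Series AB
  monomial = foldr letter one

  coefficient-expand-word : ∀ v → coefficient (expand-word v) ≐ monomial v
  coefficient-expand-word []      w = refl
  coefficient-expand-word (x ∷ v) w = begin
    coefficient (cd-letter x *ᴾ expand-word v) w      ≈⟨ coefficient-* (cd-letter x) (expand-word v) w ⟩
    act (cd-letter x) (coefficient (expand-word v)) w ≈⟨ act-congʳ (cd-letter x) (coefficient-expand-word v) w ⟩
    act (cd-letter x) (monomial v) w                  ≈⟨ act-letter x ⟩
    letter x (monomial v) w                           ∎
    where
    act-letter : ∀ x → act (cd-letter x) (monomial v) w ≈ letter x (monomial v) w
    act-letter 𝐜 = act-𝐜 (monomial v) w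
    act-letter 𝐝 = act-𝐝 (monomial v) w

  coefficient-expand : ∀ Φ → coefficient (expand Φ) ≐ λ w → ∑[ t ← Φ ] (proj₁ t * monomial (proj₂ t) w)
  coefficient-expand Φ w = trans (coefficient-∑ Φ (λ t → proj₁ t • expand-word (proj₂ t)) w)
    (∑-cong Φ λ (r , v) → trans (coefficient-• r (expand-word v) w) (*-congˡ (coefficient-expand-word v w)))

  -- Membership in the subalgebra generated by 𝐜 and 𝐝. The cd-polynomial is kept as data, so that
  -- it can serve as the cd-index in the end.
  IsCD : Series AB → Set
  IsCD s = ∃ λ Φ → coefficient (expand Φ) ≐ s

  IsCD-resp-≐ : ∀ {s t} → s ≐ t → IsCD s → IsCD t
  IsCD-resp-≐ s≐t (Φ , Φ≐s) = Φ , λ w → trans (Φ≐s w) (s≐t w)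

  zero-isCD : ∀ {s} → (∀ w → s w ≈ 0#) → IsCD s
  zero-isCD s≈0 = [] , λ w → sym (s≈0 w)

  one-isCD : IsCD one
  one-isCD = constant 1# , λ w → trans (coefficient-expand (constant 1#) w) (trans (+-identityʳ _) (*-identityˡ _))

  +-isCD : ∀ {s t} → IsCD s → IsCD t → IsCD (λ w → s w + t w)
  +-isCD {s} {t} (Φ , Φ≐s) (Ψ , Ψ≐t) = Φ +ᴾ Ψ , λ w → begin
    coefficient (expand (Φ +ᴾ Ψ)) w                       ≈⟨ coefficient-expand (Φ +ᴾ Ψ) w ⟩
    (∑[ t ← Φ +ᴾ Ψ ] (proj₁ t * monomial (proj₂ t) w))    ≈⟨ ∑-++ Φ Ψ _ ⟩
    _                                                     ≈⟨ +-cong (coefficient-expand Φ w) (coefficient-expand Ψ w) ⟨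
    coefficient (expand Φ) w + coefficient (expand Ψ) w   ≈⟨ +-cong (Φ≐s w) (Ψ≐t w) ⟩
    s w + t w                                             ∎

  *-isCD : ∀ r {s} → IsCD s → IsCD (λ w → r * s w)
  *-isCD r {s} (Φ , Φ≐s) = r • Φ , λ w → begin
    coefficient (expand (r • Φ)) w                        ≈⟨ coefficient-expand (r • Φ) w ⟩
    (∑[ t ← r • Φ ] (proj₁ t * monomial (proj₂ t) w))     ≈⟨ ∑-map _ Φ _ ⟩
    (∑[ t ← Φ ] ((r * proj₁ t) * monomial (proj₂ t) w))   ≈⟨ ∑-cong Φ (λ _ → *-assoc r _ _) ⟩
    (∑[ t ← Φ ] (r * (proj₁ t * monomial (proj₂ t) w)))   ≈⟨ ∑-*ˡ Φ r _ ⟩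
    r * (∑[ t ← Φ ] (proj₁ t * monomial (proj₂ t) w))     ≈⟨ *-congˡ (coefficient-expand Φ w) ⟨
    r * coefficient (expand Φ) w                          ≈⟨ *-congˡ (Φ≐s w) ⟩
    r * s w                                               ∎

  letter-isCD : ∀ x {s} → IsCD s → IsCD (letter x s)
  letter-isCD x {s} (Φ , Φ≐s) = xΦ , λ w → begin
    coefficient (expand xΦ) w                                       ≈⟨ coefficient-expand xΦ w ⟩
    (∑[ t ← xΦ ] (proj₁ t * monomial (proj₂ t) w))                  ≈⟨ ∑-map _ Φ _ ⟩
    (∑[ t ← Φ ] (proj₁ t * letter x (monomial (proj₂ t)) w))        ≈⟨ ∑-cong Φ (λ (r , v) → *-homo L r (monomial v) w) ⟨
    (∑[ t ← Φ ] letter x (λ u → proj₁ t * monomial (proj₂ t) u) w)  ≈⟨ ∑-homo L Φ (λ t u → proj₁ t * monomial (proj₂ t) u) w ⟨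
    letter x (λ u → ∑[ t ← Φ ] (proj₁ t * monomial (proj₂ t) u)) w  ≈⟨ cong L (coefficient-expand Φ) w ⟨
    letter x (coefficient (expand Φ)) w                             ≈⟨ cong L Φ≐s w ⟩
    letter x s w                                                    ∎
    where
    L = letter-linear x
    xΦ = map (λ (r , v) → r , x ∷ v) Φ

  ∑-isCD : ∀ {I : Set} (xs : List I) {f : I → Series AB} → (∀ x → IsCD (f x)) → IsCD (λ w → ∑[ x ← xs ] f x w)
  ∑-isCD []       cd = zero-isCD λ _ → refl
  ∑-isCD (x ∷ xs) cd = +-isCD (cd x) (∑-isCD xs cd)

  -- A single factor 𝐚 - 𝐛 may lead out of the subalgebra, while its square is 𝐜² - 2𝐝. This is why
  -- the parity of exponents governs the later argument.
  E²-isCD : ∀ {s} → IsCD s → IsCD (E (E s))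
  E²-isCD {s} cd = IsCD-resp-≐ (λ w → sym (E²≈ w))
    (+-isCD (letter-isCD 𝐜 (letter-isCD 𝐜 cd)) (*-isCD (- 1#) (+-isCD Ds Ds)))
    where
    Ds = letter-isCD 𝐝 cd
    E²≈ : ∀ w → E (E s) w ≈ C (C s) w + - 1# * (D s w + D s w)
    E²≈ w = trans (E²≈C²-2D s w) (+-congˡ (sym (-1*x≈-x _)))

  -- If f = 𝐜 g + 𝐝 h, then coefficient-wise g and h can be read off f.

  unletter : CD → Series AB → Series AB
  unletter 𝐜 f []      = f (𝐛 ∷ [])
  unletter 𝐜 f (x ∷ w) = f (x ∷ x ∷ w)
  unletter 𝐝 f w       = f (𝐚 ∷ 𝐛 ∷ w) - f (𝐛 ∷ 𝐛 ∷ w)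

  -- Strips the letters of the cd-word one by one from the left. It is defined on every series, and
  -- on expansions it inverts `expand`.
  extract : Series AB → Series CD
  extract f []      = f []
  extract f (x ∷ u) = extract (unletter x f) u

  unletter-linear : ∀ x → Linear (unletter x)
  unletter-linear 𝐜 = record
    { cong   = λ { f≐g [] → f≐g _ ; f≐g (_ ∷ _) → f≐g _ }
    ; +-homo = λ { f g [] → refl ; f g (_ ∷ _) → refl }
    ; *-homo = λ { r f [] → refl ; r f (_ ∷ _) → refl }
    }
  unletter-linear 𝐝 = record
    { cong   = λ f≐g w → +-cong (f≐g _) (-‿cong (f≐g _))
    ; +-homo = λ f g w → solve 4 (λ a b c d → (a :+ b) :- (c :+ d) := (a :- c) :+ (b :- d)) refl _ _ _ _
    ; *-homo = λ r f w → solve 3 (λ r a b → r :* a :- r :* b := r :* (a :- b)) refl _ _ _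
    }

  extract-linear : Linear extract
  extract-linear = record { cong = congᵉ ; +-homo = +-homoᵉ ; *-homo = *-homoᵉ }
    where
    congᵉ : ∀ {f g} → f ≐ g → extract f ≐ extract g
    congᵉ f≐g []      = f≐g []
    congᵉ f≐g (x ∷ u) = congᵉ (cong (unletter-linear x) f≐g) u
    +-homoᵉ : ∀ f g → extract (λ w → f w + g w) ≐ λ u → extract f u + extract g u
    +-homoᵉ f g []      = refl
    +-homoᵉ f g (x ∷ u) = trans (congᵉ (+-homo (unletter-linear x) f g) u) (+-homoᵉ _ _ u)
    *-homoᵉ : ∀ r f → extract (λ w → r * f w) ≐ λ u → r * extract f u
    *-homoᵉ r f []      = refl
    *-homoᵉ r f (x ∷ u) = trans (congᵉ (*-homo (unletter-linear x) r f) u) (*-homoᵉ r _ u)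

  -- A series 𝐝h vanishes on 𝐛 and on words with a doubled first letter, so `unletter 𝐜` kills it. A
  -- series 𝐜g takes equal values on 𝐚𝐛w and 𝐛𝐛w, so `unletter 𝐝` kills it. On a matching letter
  -- `unletter` undoes the multiplication.
  extract-monomial : ∀ v u → extract (monomial v) u ≈ (if does (≡-dec _≟ᶜᴰ_ v u) then 1# else 0#)
  extract-monomial []      []      = one-[]
  extract-monomial []      (x ∷ u) = 0-homo extract-linear (unletter-one x) u
    where
    unletter-one : ∀ x w → unletter x one w ≈ 0#
    unletter-one 𝐜 []      = one-∷ 𝐛 []
    unletter-one 𝐜 (x ∷ w) = one-∷ x (x ∷ w)
    unletter-one 𝐝 w       = -‿inverseʳ _
  extract-monomial (𝐜 ∷ v) []      = refl
  extract-monomial (𝐝 ∷ v) []      = refl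
  extract-monomial (𝐜 ∷ v) (𝐜 ∷ u) = trans (cong extract-linear (λ { [] → refl ; (_ ∷ _) → refl }) u) (extract-monomial v u)
  extract-monomial (𝐜 ∷ v) (𝐝 ∷ u) = 0-homo extract-linear (λ w → -‿inverseʳ _) u
  extract-monomial (𝐝 ∷ v) (𝐜 ∷ u) = 0-homo extract-linear (λ { [] → refl ; (𝐚 ∷ _) → refl ; (𝐛 ∷ _) → refl }) u
  extract-monomial (𝐝 ∷ v) (𝐝 ∷ u) =
    trans (cong extract-linear (λ w → solve 1 (λ x → x :- con ℤ.0ℤ := x) refl (monomial v w)) u) (extract-monomial v u)

  -- By linearity it suffices to treat monomials. The resulting left inverse of the expansion is the
  -- source of both uniqueness and integrality.
  extract-expand : ∀ Φ → extract (coefficient (expand Φ)) ≐ coefficientᶜᴰ Φ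
  extract-expand Φ u = begin
    extract (coefficient (expand Φ)) u
      ≈⟨ cong extract-linear (coefficient-expand Φ) u ⟩
    extract (λ w → ∑[ t ← Φ ] (proj₁ t * monomial (proj₂ t) w)) u
      ≈⟨ ∑-homo extract-linear Φ (λ t w → proj₁ t * monomial (proj₂ t) w) u ⟩
    (∑[ t ← Φ ] extract (λ w → proj₁ t * monomial (proj₂ t) w) u)
      ≈⟨ ∑-cong Φ (λ (r , v) → trans (*-homo extract-linear r (monomial v) u)
           (trans (*-congˡ (extract-monomial v u)) (*-if r (does (≡-dec _≟ᶜᴰ_ v u))))) ⟩
    coefficientᶜᴰ Φ u ∎
    where
    *-if : ∀ r b → r * (if b then 1# else 0#) ≈ (if b then r else 0#)
    *-if r true  = *-identityʳ r
    *-if r false = zeroʳ r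

  -- Extraction only selects coefficients and subtracts them; no division takes place.
  extract-isInteger : ∀ {f} → (∀ w → IsInteger (f w)) → ∀ u → IsInteger (extract f u)
  extract-isInteger int []      = int []
  extract-isInteger int (x ∷ u) = extract-isInteger (unletter-isInteger x int) u
    where
    unletter-isInteger : ∀ x {f} → (∀ w → IsInteger (f w)) → ∀ w → IsInteger (unletter x f w)
    unletter-isInteger 𝐜 int []      = int _
    unletter-isInteger 𝐜 int (_ ∷ _) = int _
    unletter-isInteger 𝐝 int w       = +-isInteger (int _) (neg-isInteger (int _))

-- The entry `y` survives only the filter by `Q?`, which makes the comparison strict. It supplies a
-- decreasing measure on the poset.
length-filter-< : ∀ {I : Set} {P Q : Pred I 0ℓ} (P? : Decidable P) (Q? : Decidable Q) →
                  (∀ {x} → P x → Q x) → ∀ {y xs} → y ∈ xs → Q y → ¬ P y →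
                  length (filter P? xs) ℕ.< length (filter Q? xs)
length-filter-< {P = P} {Q} P? Q? P⇒Q = strict
  where
  weak : ∀ xs → length (filter P? xs) ℕ.≤ length (filter Q? xs)
  weak [] = ℕ.z≤n
  weak (x ∷ xs) with P? x | Q? x
  ... | yes _ | yes _ = ℕ.s≤s (weak xs)
  ... | yes p | no ¬q = contradiction (P⇒Q p) ¬q
  ... | no _  | yes _ = ℕ.m≤n⇒m≤1+n (weak xs)
  ... | no _  | no _  = weak xs
  strict : ∀ {y xs} → y ∈ xs → Q y → ¬ P y → length (filter P? xs) ℕ.< length (filter Q? xs)
  strict {xs = x ∷ xs} (here ≡.refl) q ¬p with P? x | Q? x
  ... | yes p | _     = contradiction p ¬p
  ... | no _  | yes _ = ℕ.s≤s (weak xs)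
  ... | no _  | no ¬q = contradiction q ¬q
  strict {xs = x ∷ xs} (there y∈xs) q ¬p with P? x | Q? x
  ... | yes _ | yes _ = ℕ.s≤s (strict y∈xs q ¬p)
  ... | yes p | no ¬q = contradiction (P⇒Q p) ¬q
  ... | no _  | yes _ = ℕ.m≤n⇒m≤1+n (strict y∈xs q ¬p)
  ... | no _  | no _  = strict y∈xs q ¬p

-- The ab-index as a sum over chains, and its recursion on the first step.

module ABIndex (R : CommutativeRing 0ℓ 0ℓ) (P : QuasiGraded.QuasiGradedPoset R)
               (1̂ : QuasiGraded.QuasiGradedPoset.Carrier P) where

  open CommutativeRing R renaming (Carrier to A)
  open Integers R
  open IntegerHomomorphism R
  open Sums R
  open Series R
  open Linear
  open CDExpansion R
  open Multiplication R _≟ᴬᴮ_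
  open NonCommutativePolynomial R using (var; _•_) renaming (_*_ to _*ᴾ_; _^_ to _^ᴾ_)
  open NonCommutativePolynomial.Coefficients R _≟ᴬᴮ_ using (coefficient)
  open QuasiGraded R using (module QuasiGradedPoset)
  open QuasiGradedPoset P renaming (Carrier to V)
  open import Relation.Binary.Reasoning.Setoid setoid

  <-trans : ∀ {x y z} → x < y → y < z → x < z
  <-trans = ToStrict.<-trans _≡_ _≤_ (IsDecPartialOrder.isPartialOrder isDecPartialOrder)

  elements-unique : Unique elements
  elements-unique = map⁺ (Injection.injective (↔⇒↣ finite)) (allFin⁺ size)

  ∈-elements : ∀ x → x ∈ elements
  ∈-elements x = ≡.subst (_∈ elements) (Inverse.strictlyInverseˡ finite x)
    (∈-map⁺ (Inverse.to finite) (∈-allFin (Inverse.from finite x)))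

  -- The strict part `ζ̄ - δ` in the incidence algebra. Its zeros let sums over `x < y` range over
  -- all of `elements`.
  η : V → V → A
  η x y = if does (x <? y) then ζ̄ x y else 0#

  η≈ζ̄ : ∀ {x y} → x < y → η x y ≈ ζ̄ x y
  η≈ζ̄ {x} {y} x<y = reflexive (≡.cong (if_then ζ̄ x y else 0#) (dec-true (x <? y) x<y))

  η≈0 : ∀ {x y} → ¬ x < y → η x y ≈ 0#
  η≈0 {x} {y} x≮y = reflexive (≡.cong (if_then ζ̄ x y else 0#) (dec-false (x <? y) x≮y))

  δ-refl : ∀ x → δ x x ≈ 1#
  δ-refl x = reflexive (≡.cong (if_then 1# else 0#) (dec-true (x ≟ x) ≡.refl))

  δ-≢ : ∀ {x y} → ¬ x ≡ y → δ x y ≈ 0#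
  δ-≢ {x} {y} x≢y = reflexive (≡.cong (if_then 1# else 0#) (dec-false (x ≟ y) x≢y))

  exponent : V → V → ℕ
  exponent x y = ρ[ x , y ] ∸ 1

  G : V → V → Series AB → Series AB
  G x y s w = η x y * E^ (exponent x y) s w

  G-linear : ∀ x y → Linear (G x y)
  G-linear x y = record
    { cong   = λ f≐g w → *-congˡ (cong L f≐g w)
    ; +-homo = λ f g w → trans (*-congˡ (+-homo L f g w)) (distribˡ _ _ _)
    ; *-homo = λ r f w → trans (*-congˡ (*-homo L r f w))
        (solve 3 (λ a r b → a :* (r :* b) := r :* (a :* b)) refl (η x y) r (E^ (exponent x y) f w))
    }
    where L = E^-linear (exponent x y)

  G≈0 : ∀ {x y} → ¬ x < y → ∀ s w → G x y s w ≈ 0#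
  G≈0 x≮y s w = trans (*-congʳ (η≈0 x≮y)) (zeroˡ _)

  -- Contribution of the chains with k + 1 steps to the 𝐚𝐛-index of [x, 1̂].
  Ψ-part : ℕ → V → Series AB
  Ψ-part k x w = ∑[ c ← chainsOfLength (suc k) x 1̂ ] (ζ̄-product c * coefficient (weight c) w)

  -- Sorts the chains by their second element `z`.
  ∑-chains-suc : ∀ k x (h : List V → A) →
    ∑ (chainsOfLength (suc k) x 1̂) h ≈
    ∑[ z ← elements ] (if does (x <? z) then ∑[ c ← chainsOfLength k z 1̂ ] h (x ∷ c) else 0#)
  ∑-chains-suc k x h = begin
    ∑ (chainsOfLength (suc k) x 1̂) h
      ≈⟨ ∑-concatMap _ (filter (x <?_) elements) h ⟩
    ∑[ z ← filter (x <?_) elements ] ∑ (map (x ∷_) (chainsOfLength k z 1̂)) h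
      ≈⟨ ∑-cong (filter (x <?_) elements) (λ z → ∑-map (x ∷_) (chainsOfLength k z 1̂) h) ⟩
    ∑[ z ← filter (x <?_) elements ] ∑[ c ← chainsOfLength k z 1̂ ] h (x ∷ c)
      ≈⟨ ∑-filter (x <?_) elements _ ⟩
    _ ∎

  chain-head : ∀ k z → All (λ c → ∃ λ c′ → c ≡ z ∷ c′) (chainsOfLength k z 1̂)
  chain-head zero z with does (z ≟ 1̂)
  ... | true  = ([] , ≡.refl) ∷ []
  ... | false = []
  chain-head (suc k) z = All.concat⁺ (All.map⁺ (All.universal
    (λ y → All.map⁺ (All.universal (λ c → c , ≡.refl) (chainsOfLength k y 1̂))) (filter (z <?_) elements)))

  -- `weight` branches on the presence of a third entry, so unfolding it at `x ∷ c` requires the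
  -- first two entries of `c` to be visible.
  chain-head₂ : ∀ k z → All (λ c → ∃ λ y → ∃ λ c′ → c ≡ z ∷ y ∷ c′) (chainsOfLength (suc k) z 1̂)
  chain-head₂ k z = All.concat⁺ (All.map⁺ (All.universal
    (λ y → All.map⁺ (All.map (λ { (c′ , ≡.refl) → y , c′ , ≡.refl }) (chain-head k y))) (filter (z <?_) elements)))

  coefficient-weight : ∀ x z y c →
    coefficient (weight (x ∷ z ∷ y ∷ c)) ≐ E^ (exponent x z) (shift 𝐛 (coefficient (weight (z ∷ y ∷ c))))
  coefficient-weight x z y c w = begin
    coefficient (𝐚-𝐛 ^ᴾ n *ᴾ var 𝐛 *ᴾ weight c′) w      ≈⟨ coefficient-* (𝐚-𝐛 ^ᴾ n *ᴾ var 𝐛) (weight c′) w ⟩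
    act (𝐚-𝐛 ^ᴾ n *ᴾ var 𝐛) s w                         ≈⟨ act-* (𝐚-𝐛 ^ᴾ n) (var 𝐛) s w ⟩
    act (𝐚-𝐛 ^ᴾ n) (act (var 𝐛) s) w                    ≈⟨ act-a-b^ n (act (var 𝐛) s) w ⟩
    E^ n (act (var 𝐛) s) w                              ≈⟨ cong (E^-linear n) (act-var 𝐛 s) w ⟩
    E^ n (shift 𝐛 s) w                                  ∎
    where
    n = exponent x z
    c′ = z ∷ y ∷ c
    s = coefficient (weight c′)

  -- Only the chain `x < 1̂` has a single step. The factor `δ z 1̂` writes its term as a sum over
  -- all `z`, in the same form as for the longer chains.
  Ψ-part-zero : ∀ x w → Ψ-part 0 x w ≈ ∑[ z ← elements ] G x z (λ u → δ z 1̂ * one u) w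
  Ψ-part-zero x w = trans (∑-chains-suc 0 x _) (∑-cong elements λ z → summand z (x <? z) (z ≟ 1̂))
    where
    h : List V → A
    h c = ζ̄-product c * coefficient (weight c) w
    summand : ∀ z (p : Dec (x < z)) (q : Dec (z ≡ 1̂)) →
      (if does p then ∑[ c ← (if does q then [ [ z ] ] else []) ] h (x ∷ c) else 0#) ≈
      (if does p then ζ̄ x z else 0#) * E^ (exponent x z) (λ u → (if does q then 1# else 0#) * one u) w
    summand z (no _)  q       = sym (zeroˡ _)
    summand z (yes _) (no _)  = sym (trans (*-congˡ (0-homo (E^-linear (exponent x z)) (λ u → zeroˡ (one u)) w)) (zeroʳ _))
    summand z (yes _) (yes _) = trans (+-identityʳ _) (*-cong (*-identityʳ _)
      (trans (coefficient-a-b^ (exponent x z) w) (cong (E^-linear (exponent x z)) (λ u → sym (*-identityˡ (one u))) w)))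

  -- The first step ends at `z`, and its power of 𝐚 - 𝐛 is followed by the separator 𝐛 and the
  -- weight of the remaining chain from `z`.
  Ψ-part-suc : ∀ k x w → Ψ-part (suc k) x w ≈ ∑[ z ← elements ] G x z (shift 𝐛 (Ψ-part k z)) w
  Ψ-part-suc k x w = trans (∑-chains-suc (suc k) x h) (∑-cong elements λ z → summand z (x <? z))
    where
    h : List V → A
    h c = ζ̄-product c * coefficient (weight c) w
    module _ (z : V) where
      cs = chainsOfLength (suc k) z 1̂
      L = ∘-linear (E^-linear (exponent x z)) (shift-linear 𝐛)
      T : Series AB → Series AB
      T s = E^ (exponent x z) (shift 𝐛 s)
      chain : ∀ c → (∃ λ y → ∃ λ c′ → c ≡ z ∷ y ∷ c′) →
              h (x ∷ c) ≈ ζ̄ x z * T (λ u → ζ̄-product c * coefficient (weight c) u) w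
      chain c (y , c′ , ≡.refl) = begin
        (ζ̄ x z * ζ̄-product c) * coefficient (weight (x ∷ c)) w    ≈⟨ *-congˡ (coefficient-weight x z y c′ w) ⟩
        (ζ̄ x z * ζ̄-product c) * T (coefficient (weight c)) w      ≈⟨ *-assoc _ _ _ ⟩
        ζ̄ x z * (ζ̄-product c * T (coefficient (weight c)) w)      ≈⟨ *-congˡ (*-homo L _ _ w) ⟨
        ζ̄ x z * T (λ u → ζ̄-product c * coefficient (weight c) u) w ∎
      summand : (p : Dec (x < z)) →
        (if does p then ∑[ c ← cs ] h (x ∷ c) else 0#) ≈ (if does p then ζ̄ x z else 0#) * T (Ψ-part k z) w
      summand (no _)  = sym (zeroˡ _)
      summand (yes _) = begin
        ∑[ c ← cs ] h (x ∷ c)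
          ≈⟨ ∑-cong-All (All.map (λ {c} → chain c) (chain-head₂ k z)) ⟩
        ∑[ c ← cs ] (ζ̄ x z * T (λ u → ζ̄-product c * coefficient (weight c) u) w)
          ≈⟨ ∑-*ˡ cs (ζ̄ x z) _ ⟩
        ζ̄ x z * (∑[ c ← cs ] T (λ u → ζ̄-product c * coefficient (weight c) u) w)
          ≈⟨ *-congˡ (∑-homo L cs (λ c u → ζ̄-product c * coefficient (weight c) u) w) ⟨
        ζ̄ x z * T (Ψ-part k z) w ∎

  -- Each step of a chain decreases it, so it bounds the number of steps of the chains starting at x.
  above : V → ℕ
  above x = length (filter (x <?_) elements)

  above-< : ∀ {x y} → x < y → above y ℕ.< above x
  above-< {x} {y} x<y =
    length-filter-< (y <?_) (x <?_) (<-trans x<y) (∈-elements y) x<y (λ y<y → proj₂ y<y ≡.refl)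

  above≤size : ∀ x → above x ℕ.≤ size
  above≤size x = ℕ.≤-trans (length-filter (x <?_) elements)
    (ℕ.≤-reflexive (≡.trans (length-map _ (allFin size)) (length-tabulate _)))

  -- A chain with `k + 1` steps has `k + 1` distinct elements strictly above `x`. Hence the cutoff
  -- at `size` in the definition of `chains` loses no chain.
  Ψ-part-vanishes : ∀ k x → above x ℕ.≤ k → ∀ w → Ψ-part k x w ≈ 0#
  Ψ-part-vanishes zero x above≤0 w = trans (Ψ-part-zero x w) (∑-zero elements λ z →
    G≈0 (λ x<z → ℕ.n≮0 (ℕ.<-≤-trans (above-< x<z) above≤0)) _ w)
  Ψ-part-vanishes (suc k) x above≤k w = trans (Ψ-part-suc k x w) (∑-zero elements summand)
    where
    summand : ∀ z → G x z (shift 𝐛 (Ψ-part k z)) w ≈ 0#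
    summand z with x <? z
    ... | no x≮z = G≈0 x≮z _ w
    ... | yes x<z = trans (*-congˡ (0-homo (∘-linear (E^-linear (exponent x z)) (shift-linear 𝐛))
      (Ψ-part-vanishes k z (ℕ.s≤s⁻¹ (ℕ.<-≤-trans (above-< x<z) above≤k))) w)) (zeroʳ _)

  Ψ-upTo : ℕ → V → Series AB
  Ψ-upTo n x w = ∑[ k ← upTo n ] Ψ-part k x w

  Ψ : V → Series AB
  Ψ x = coefficient (ab-index x 1̂)

  Ψ≐Ψ-upTo : ∀ x → Ψ x ≐ Ψ-upTo size x
  Ψ≐Ψ-upTo x w = begin
    coefficient (ab-index x 1̂) w
      ≈⟨ coefficient-∑ (chains x 1̂) (λ c → ζ̄-product c • weight c) w ⟩
    ∑[ c ← chains x 1̂ ] coefficient (ζ̄-product c • weight c) w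
      ≈⟨ ∑-cong (chains x 1̂) (λ c → coefficient-• (ζ̄-product c) (weight c) w) ⟩
    ∑[ c ← chains x 1̂ ] (ζ̄-product c * coefficient (weight c) w)
      ≈⟨ ∑-concatMap (λ k → chainsOfLength (suc k) x 1̂) (upTo size) _ ⟩
    Ψ-upTo size x w ∎

  φ : V → Series AB
  φ z u = δ z 1̂ * one u + shift 𝐛 (Ψ z) u

  Ψ-recursion : ∀ x w → Ψ x w ≈ ∑[ z ← elements ] G x z (φ z) w
  Ψ-recursion x w = begin
    Ψ x w
      ≈⟨ Ψ≐Ψ-upTo x w ⟩
    Ψ-upTo size x w
      ≈⟨ +-identityʳ _ ⟨
    Ψ-upTo size x w + 0#
      -- A vanishing term with index `size` is added, so that `size` terms remain after the shortest
      -- chains are split off and they reassemble to `Ψ z`.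
      ≈⟨ +-congˡ (Ψ-part-vanishes size x (above≤size x) w) ⟨
    Ψ-upTo size x w + Ψ-part size x w
      ≈⟨ ∑-upTo-suc size (λ k → Ψ-part k x w) ⟨
    Ψ-upTo (suc size) x w
      ≈⟨ ∑-upTo-shift size (λ k → Ψ-part k x w) ⟩
    Ψ-part 0 x w + (∑[ k ← upTo size ] Ψ-part (suc k) x w)
      ≈⟨ +-cong (Ψ-part-zero x w) (∑-cong (upTo size) λ k → Ψ-part-suc k x w) ⟩
    (∑[ z ← elements ] G x z (δ1 z) w) + (∑[ k ← upTo size ] ∑[ z ← elements ] G x z (shift 𝐛 (Ψ-part k z)) w)
      ≈⟨ +-congˡ (∑-swap (upTo size) elements _) ⟩
    (∑[ z ← elements ] G x z (δ1 z) w) + (∑[ z ← elements ] ∑[ k ← upTo size ] G x z (shift 𝐛 (Ψ-part k z)) w)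
      ≈⟨ ∑-+ elements _ _ ⟨
    ∑[ z ← elements ] (G x z (δ1 z) w + (∑[ k ← upTo size ] G x z (shift 𝐛 (Ψ-part k z)) w))
      ≈⟨ ∑-cong elements summand ⟩
    ∑[ z ← elements ] G x z (φ z) w ∎
    where
    δ1 : V → Series AB
    δ1 z u = δ z 1̂ * one u
    summand : ∀ z → G x z (δ1 z) w + (∑[ k ← upTo size ] G x z (shift 𝐛 (Ψ-part k z)) w) ≈ G x z (φ z) w
    summand z = begin
      G x z (δ1 z) w + (∑[ k ← upTo size ] G x z (shift 𝐛 (Ψ-part k z)) w)
        ≈⟨ +-congˡ (∑-homo L (upTo size) (λ k → Ψ-part k z) w) ⟨
      G x z (δ1 z) w + G x z (shift 𝐛 (Ψ-upTo size z)) w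
        ≈⟨ +-congˡ (cong L (Ψ≐Ψ-upTo z) w) ⟨
      G x z (δ1 z) w + G x z (shift 𝐛 (Ψ z)) w
        ≈⟨ +-homo (G-linear x z) (δ1 z) (shift 𝐛 (Ψ z)) w ⟨
      G x z (φ z) w ∎
      where L = ∘-linear (G-linear x z) (shift-linear 𝐛)

  -- Integrality of the coefficients of the ab-index.

  module _ (integral : IntegerValued) where

    E^-isInteger : ∀ n {s} → (∀ w → IsInteger (s w)) → ∀ w → IsInteger (E^ n s w)
    E^-isInteger zero    int w       = int w
    E^-isInteger (suc n) int []      = 0#-isInteger
    E^-isInteger (suc n) int (𝐚 ∷ w) = E^-isInteger n int w
    E^-isInteger (suc n) int (𝐛 ∷ w) = neg-isInteger (E^-isInteger n int w)

    shift-𝐛-isInteger : ∀ {s} → (∀ w → IsInteger (s w)) → ∀ w → IsInteger (shift 𝐛 s w)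
    shift-𝐛-isInteger int []      = 0#-isInteger
    shift-𝐛-isInteger int (𝐚 ∷ w) = 0#-isInteger
    shift-𝐛-isInteger int (𝐛 ∷ w) = int w

    G-isInteger : ∀ x y {s} → (∀ w → IsInteger (s w)) → ∀ w → IsInteger (G x y s w)
    G-isInteger x y int w = *-isInteger η-isInteger (E^-isInteger (exponent x y) int w)
      where
      η-isInteger : IsInteger (η x y)
      η-isInteger with does (x <? y)
      ... | true  = integral x y
      ... | false = 0#-isInteger

    Ψ-part-isInteger : ∀ k x w → IsInteger (Ψ-part k x w)
    Ψ-part-isInteger zero x w = IsInteger-resp-≈ (sym (Ψ-part-zero x w))
      (∑-isInteger elements λ z → G-isInteger x z (λ u → *-isInteger (δ-isInteger z) (one-isInteger u)) w)
      where
      δ-isInteger : ∀ z → IsInteger (δ z 1̂)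
      δ-isInteger z with does (z ≟ 1̂)
      ... | true  = 1#-isInteger
      ... | false = 0#-isInteger
      one-isInteger : ∀ u → IsInteger (one u)
      one-isInteger []      = IsInteger-resp-≈ (sym one-[]) 1#-isInteger
      one-isInteger (x ∷ u) = IsInteger-resp-≈ (sym (one-∷ x u)) 0#-isInteger
    Ψ-part-isInteger (suc k) x w = IsInteger-resp-≈ (sym (Ψ-part-suc k x w))
      (∑-isInteger elements λ z → G-isInteger x z (shift-𝐛-isInteger (Ψ-part-isInteger k z)) w)

    Ψ-isInteger : ∀ x w → IsInteger (Ψ x w)
    Ψ-isInteger x w = IsInteger-resp-≈ (sym (Ψ≐Ψ-upTo x w)) (∑-isInteger (upTo size) λ k → Ψ-part-isInteger k x w)

-- The Eulerian relation turned into an identity for the ab-index.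

module EulerianABIndex (R : CommutativeRing 0ℓ 0ℓ) (P : QuasiGraded.QuasiGradedPoset R)
                       (eulerian : QuasiGraded.QuasiGradedPoset.Eulerian P)
                       (1̂ : QuasiGraded.QuasiGradedPoset.Carrier P) where

  open CommutativeRing R renaming (Carrier to A)
  open IntegerHomomorphism R
  open Sums R
  open Series R
  open Linear
  open CDExpansion R
  open Multiplication R _≟ᴬᴮ_
  open QuasiGraded R using (module QuasiGradedPoset)
  open QuasiGradedPoset P renaming (Carrier to V)
  open RawSemiringDefs (Semiring.rawSemiring semiring) using (_^_)
  open ABIndex R P 1̂
  open import Relation.Binary.Reasoning.Setoid setoid

  sgn : V → V → A
  sgn x y = (- 1#) ^ ρ[ x , y ]

  sgn-refl : ∀ x → sgn x x ≈ 1#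
  sgn-refl x = reflexive (≡.cong ((- 1#) ^_) (ℕ.n∸n≡0 (ρ x)))

  ζ̄≈η : ∀ {x y} → ¬ x ≡ y → ζ̄ x y ≈ η x y
  ζ̄≈η {x} {y} x≢y = case x ≤? y of λ where
    (yes x≤y) → sym (η≈ζ̄ (x≤y , x≢y))
    (no x≰y)  → trans (ζ̄-support x≰y) (sym (η≈0 (λ x<y → x≰y (proj₁ x<y))))

  -- By transitivity no `y` lies strictly between, so both sides vanish. With this case the relation
  -- can be summed over all pairs.
  η-relation-≮ : ∀ {x z} → ¬ x < z →
    ∑[ y ← elements ] (sgn x y * (η x y * η y z)) ≈ - (sgn x z * η x z + η x z)
  η-relation-≮ {x} {z} x≮z = begin
    ∑[ y ← elements ] (sgn x y * (η x y * η y z))  ≈⟨ ∑-zero elements (λ y → trans (*-congˡ (summand y)) (zeroʳ _)) ⟩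
    0#                                             ≈⟨ solve 1 (λ s → con ℤ.0ℤ := :- (s :* con ℤ.0ℤ :+ con ℤ.0ℤ)) refl (sgn x z) ⟩
    - (sgn x z * 0# + 0#)                          ≈⟨ -‿cong (+-cong (*-congˡ (η≈0 x≮z)) (η≈0 x≮z)) ⟨
    - (sgn x z * η x z + η x z)                    ∎
    where
    summand : ∀ y → η x y * η y z ≈ 0#
    summand y = case x <? y of λ where
      (no x≮y)  → trans (*-congʳ (η≈0 x≮y)) (zeroˡ _)
      (yes x<y) → trans (*-congˡ (η≈0 (λ y<z → x≮z (<-trans x<y y<z)))) (zeroʳ _)

  -- The Eulerian relation with the terms y = x and y = z split off.
  η-relation-< : ∀ {x z} → x < z →
    ∑[ y ← elements ] (sgn x y * (η x y * η y z)) ≈ - (sgn x z * η x z + η x z)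
  η-relation-< {x} {z} (x≤z , x≢z) = begin
    Σηη                                                            ≈⟨ solve 3 (λ a b c → c := (a :+ (b :+ c)) :- (b :+ a)) refl (η x z) (sgn x z * η x z) Σηη ⟩
    (η x z + (sgn x z * η x z + Σηη)) - (sgn x z * η x z + η x z)  ≈⟨ +-congʳ split ⟨
    ∑ elements f - (sgn x z * η x z + η x z)                       ≈⟨ +-congʳ total ⟩
    0# - (sgn x z * η x z + η x z)                                 ≈⟨ +-identityˡ _ ⟩
    - (sgn x z * η x z + η x z)                                    ∎
    where
    Σηη = ∑[ y ← elements ] (sgn x y * (η x y * η y z))
    f : V → A
    f y = sgn x y * (ζ̄ x y * ζ̄ y z)

    f≈0 : ∀ y → ¬ (x ≤ y × y ≤ z) → f y ≈ 0#
    f≈0 y y∉ = case x ≤? y of λ where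
      (no x≰y)  → trans (*-congˡ (trans (*-congʳ (ζ̄-support x≰y)) (zeroˡ _))) (zeroʳ _)
      (yes x≤y) → trans (*-congˡ (trans (*-congˡ (ζ̄-support (λ y≤z → y∉ (x≤y , y≤z)))) (zeroʳ _))) (zeroʳ _)

    total : ∑ elements f ≈ 0#
    total = begin
      ∑ elements f
        -- Outside the interval `ζ̄-support` kills one of the two factors, so the sum may run over
        -- all elements.
        ≈⟨ ∑-cong elements (λ y → restrict y ((x ≤? y) ×-dec (y ≤? z))) ⟨
      ∑[ y ← elements ] (if does ((x ≤? y) ×-dec (y ≤? z)) then f y else 0#)
        ≈⟨ ∑-filter (λ y → (x ≤? y) ×-dec (y ≤? z)) elements f ⟨
      ∑ (interval x z) f
        ≈⟨ eulerian x z x≤z ⟩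
      δ x z
        ≈⟨ δ-≢ x≢z ⟩
      0# ∎
      where
      restrict : ∀ y (d : Dec (x ≤ y × y ≤ z)) → (if does d then f y else 0#) ≈ f y
      restrict y (yes _) = refl
      restrict y (no y∉) = sym (f≈0 y y∉)

    δ-sum : ∀ v (g : V → A) a → g v ≈ 1# → (∀ y → ¬ v ≡ y → g y ≈ 0#) → ∑[ y ← elements ] (g y * a) ≈ a
    δ-sum v g a gv≈1 g≈0 = trans
      (∑-support elements-unique (∈-elements v) (λ y v≢y → trans (*-congʳ (g≈0 y v≢y)) (zeroˡ a)))
      (trans (*-congʳ gv≈1) (*-identityˡ a))

    summand : ∀ y → Dec (x ≡ y) → Dec (y ≡ z) →
      f y ≈ δ x y * η x z + (δ y z * (sgn x z * η x z) + sgn x y * (η x y * η y z))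
    summand y (yes ≡.refl) (yes ≡.refl) = contradiction ≡.refl x≢z
    summand y (yes ≡.refl) (no y≢z) = begin
      sgn x x * (ζ̄ x x * ζ̄ x z)
        ≈⟨ *-cong (sgn-refl x) (*-cong (ζ̄-diag x) (ζ̄≈η x≢z)) ⟩
      1# * (1# * η x z)
        ≈⟨ *-identityˡ _ ⟩
      1# * η x z
        -- The unit enters as the variable `o`, because `con ℤ.1ℤ` denotes `1# + 0#` and not `1#`
        -- itself.
        ≈⟨ solve 4 (λ o a b c → o :* a := o :* a :+ (con ℤ.0ℤ :* b :+ c :* (con ℤ.0ℤ :* a))) refl 1# (η x z) (sgn x z * η x z) (sgn x x) ⟩
      1# * η x z + (0# * (sgn x z * η x z) + sgn x x * (0# * η x z))
        ≈⟨ +-cong (*-congʳ (δ-refl x)) (+-cong (*-congʳ (δ-≢ y≢z)) (*-congˡ (*-congʳ (η≈0 λ x<x → proj₂ x<x ≡.refl)))) ⟨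
      δ x x * η x z + (δ x z * (sgn x z * η x z) + sgn x x * (η x x * η x z)) ∎
    summand y (no x≢y) (yes ≡.refl) = begin
      sgn x z * (ζ̄ x z * ζ̄ z z)
        ≈⟨ *-congˡ (*-cong (ζ̄≈η x≢z) (ζ̄-diag z)) ⟩
      sgn x z * (η x z * 1#)
        ≈⟨ solve 3 (λ o s a → s :* (a :* o) := con ℤ.0ℤ :* a :+ (o :* (s :* a) :+ s :* (a :* con ℤ.0ℤ))) refl 1# (sgn x z) (η x z) ⟩
      0# * η x z + (1# * (sgn x z * η x z) + sgn x z * (η x z * 0#))
        ≈⟨ +-cong (*-congʳ (δ-≢ x≢z)) (+-cong (*-congʳ (δ-refl z)) (*-congˡ (*-congˡ (η≈0 λ z<z → proj₂ z<z ≡.refl)))) ⟨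
      δ x z * η x z + (δ z z * (sgn x z * η x z) + sgn x z * (η x z * η z z)) ∎
    summand y (no x≢y) (no y≢z) = begin
      sgn x y * (ζ̄ x y * ζ̄ y z)
        ≈⟨ *-congˡ (*-cong (ζ̄≈η x≢y) (ζ̄≈η y≢z)) ⟩
      sgn x y * (η x y * η y z)
        ≈⟨ solve 3 (λ a b c → c := con ℤ.0ℤ :* a :+ (con ℤ.0ℤ :* b :+ c)) refl (η x z) (sgn x z * η x z) _ ⟩
      0# * η x z + (0# * (sgn x z * η x z) + sgn x y * (η x y * η y z))
        ≈⟨ +-cong (*-congʳ (δ-≢ x≢y)) (+-congʳ (*-congʳ (δ-≢ y≢z))) ⟨
      δ x y * η x z + (δ y z * (sgn x z * η x z) + sgn x y * (η x y * η y z)) ∎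

    split : ∑ elements f ≈ η x z + (sgn x z * η x z + Σηη)
    split = begin
      ∑ elements f
        ≈⟨ ∑-cong elements (λ y → summand y (x ≟ y) (y ≟ z)) ⟩
      ∑[ y ← elements ] (δ x y * η x z + (δ y z * (sgn x z * η x z) + sgn x y * (η x y * η y z)))
        ≈⟨ trans (∑-+ elements _ _) (+-congˡ (∑-+ elements _ _)) ⟩
      (∑[ y ← elements ] (δ x y * η x z)) + ((∑[ y ← elements ] (δ y z * (sgn x z * η x z))) + Σηη)
        ≈⟨ +-cong (δ-sum x (δ x) _ (δ-refl x) (λ y → δ-≢))
             (+-congʳ (δ-sum z (λ y → δ y z) _ (δ-refl z) (λ y z≢y → δ-≢ (λ y≡z → z≢y (≡.sym y≡z))))) ⟩
      η x z + (sgn x z * η x z + Σηη) ∎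

  η-relation : ∀ x z → ∑[ y ← elements ] (sgn x y * (η x y * η y z)) ≈ - (sgn x z * η x z + η x z)
  η-relation x z = case x <? z of λ where
    (yes x<z) → η-relation-< x<z
    (no x≮z)  → η-relation-≮ x≮z

  -- The successor accounts for the factor 𝐚 - 𝐛 placed between two steps: (ρ(x,y) - 1) + 1 +
  -- (ρ(y,z) - 1) = ρ(x,z) - 1, where strict monotonicity of `ρ` keeps every subtraction exact.
  exponent-+ : ∀ {x y z} → x < y → y < z → exponent x y ℕ.+ suc (exponent y z) ≡ exponent x z
  exponent-+ {x} {y} {z} x<y y<z = lemma (ρ-mono x<y) (ρ-mono y<z)
    where
    lemma : ∀ {a b c} → a ℕ.< b → b ℕ.< c → (b ∸ a ∸ 1) ℕ.+ suc (c ∸ b ∸ 1) ≡ c ∸ a ∸ 1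
    lemma {a} {b} {c} a<b b<c = ≡R.begin
      (b ∸ a ∸ 1) ℕ.+ suc (c ∸ b ∸ 1)  ≡R.≡⟨ ≡.cong ((b ∸ a ∸ 1) ℕ.+_) (ℕ.m+[n∸m]≡n (ℕ.m<n⇒0<n∸m b<c)) ⟩
      (b ∸ a ∸ 1) ℕ.+ (c ∸ b)          ≡R.≡⟨ ℕ.+-∸-comm (c ∸ b) (ℕ.m<n⇒0<n∸m a<b) ⟨
      ((b ∸ a) ℕ.+ (c ∸ b)) ∸ 1        ≡R.≡⟨ ≡.cong (_∸ 1) (ℕ.+-comm (b ∸ a) (c ∸ b)) ⟩
      ((c ∸ b) ℕ.+ (b ∸ a)) ∸ 1        ≡R.≡⟨ ≡.cong (_∸ 1) (ℕ.+-∸-assoc (c ∸ b) (ℕ.<⇒≤ a<b)) ⟨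
      ((c ∸ b) ℕ.+ b ∸ a) ∸ 1          ≡R.≡⟨ ≡.cong (λ d → d ∸ a ∸ 1) (ℕ.m∸n+n≡m (ℕ.<⇒≤ b<c)) ⟩
      c ∸ a ∸ 1                        ≡R.∎
      where module ≡R = ≡.≡-Reasoning

  -- The powers of 𝐚 - 𝐛 combine to one that does not depend on `y`. It factors out of the sum,
  -- leaving the scalar relation for `η`.
  G-relation : ∀ x z s w →
    ∑[ y ← elements ] (sgn x y * G x y (E (G y z s)) w) ≈ - (sgn x z * G x z s w + G x z s w)
  G-relation x z s w = begin
    ∑[ y ← elements ] (sgn x y * G x y (E (G y z s)) w)       ≈⟨ ∑-cong elements (λ y → summand y (x <? y) (y <? z)) ⟩
    ∑[ y ← elements ] ((sgn x y * (η x y * η y z)) * Es)      ≈⟨ ∑-*ʳ elements Es _ ⟩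
    (∑[ y ← elements ] (sgn x y * (η x y * η y z))) * Es      ≈⟨ *-congʳ (η-relation x z) ⟩
    - (sgn x z * η x z + η x z) * Es
      ≈⟨ solve 3 (λ a b e → :- (a :* b :+ b) :* e := :- (a :* (b :* e) :+ b :* e)) refl (sgn x z) (η x z) Es ⟩
    - (sgn x z * G x z s w + G x z s w)                       ∎
    where
    Es = E^ (exponent x z) s w
    summand : ∀ y → Dec (x < y) → Dec (y < z) →
      sgn x y * G x y (E (G y z s)) w ≈ (sgn x y * (η x y * η y z)) * Es
    summand y (no x≮y) _ = trans (*-congˡ (G≈0 x≮y _ w))
      (sym (trans (*-congʳ (*-congˡ (*-congʳ (η≈0 x≮y))))
        (solve 3 (λ a b e → (a :* (con ℤ.0ℤ :* b)) :* e := a :* con ℤ.0ℤ) refl (sgn x y) (η y z) Es)))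
    summand y (yes _) (no y≮z) =
      trans (*-congˡ (0-homo (∘-linear (G-linear x y) E-linear) (G≈0 y≮z s) w))
        (sym (trans (*-congʳ (*-congˡ (*-congˡ (η≈0 y≮z))))
          (solve 3 (λ a b e → (a :* (b :* con ℤ.0ℤ)) :* e := a :* con ℤ.0ℤ) refl (sgn x y) (η x y) Es)))
    summand y (yes x<y) (yes y<z) = begin
      sgn x y * (η x y * T (λ u → η y z * E^ n s u) w)      ≈⟨ *-congˡ (*-congˡ (*-homo T-linear (η y z) (E^ n s) w)) ⟩
      sgn x y * (η x y * (η y z * T (E^ n s) w))            ≡⟨ ≡.cong (λ e → sgn x y * (η x y * (η y z * e w))) exponents ⟩
      sgn x y * (η x y * (η y z * Es))
        ≈⟨ solve 4 (λ a b c e → a :* (b :* (c :* e)) := (a :* (b :* c)) :* e) refl (sgn x y) (η x y) (η y z) Es ⟩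
      (sgn x y * (η x y * η y z)) * Es                      ∎
      where
      m = exponent x y
      n = exponent y z
      T : Series AB → Series AB
      T t = E^ m (E t)
      T-linear : Linear T
      T-linear = ∘-linear (E^-linear m) E-linear
      exponents : E^ m (E^ (suc n) s) ≡ E^ (exponent x z) s
      exponents = ≡.trans (E^-+ m (suc n) s) (≡.cong (λ k → E^ k s) (exponent-+ x<y y<z))

  -- With G̃ x y = (-1)^ρ(x,y) · G x y: substituting Ψ = ∑ G φ into ∑ G̃ E Ψ, the relation for
  -- G̃ E G yields ∑ G̃ E Ψ = - ∑ G̃ φ - Ψ.
  Ψ-relation : ∀ x w →
    ∑[ y ← elements ] (sgn x y * G x y (E (Ψ y)) w) ≈ - ((∑[ z ← elements ] (sgn x z * G x z (φ z) w)) + Ψ x w)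
  Ψ-relation x w = begin
    ∑[ y ← elements ] (sgn x y * G x y (E (Ψ y)) w)
      ≈⟨ ∑-cong elements summand ⟩
    ∑[ y ← elements ] ∑[ z ← elements ] (sgn x y * G x y (E (G y z (φ z))) w)
      ≈⟨ ∑-swap elements elements _ ⟩
    ∑[ z ← elements ] ∑[ y ← elements ] (sgn x y * G x y (E (G y z (φ z))) w)
      ≈⟨ ∑-cong elements (λ z → G-relation x z (φ z) w) ⟩
    ∑[ z ← elements ] (- (sgn x z * G x z (φ z) w + G x z (φ z) w))
      ≈⟨ ∑-neg elements _ ⟩
    - (∑[ z ← elements ] (sgn x z * G x z (φ z) w + G x z (φ z) w))
      ≈⟨ -‿cong (trans (∑-+ elements _ _) (+-congˡ (sym (Ψ-recursion x w)))) ⟩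
    - ((∑[ z ← elements ] (sgn x z * G x z (φ z) w)) + Ψ x w) ∎
    where
    summand : ∀ y → sgn x y * G x y (E (Ψ y)) w ≈ ∑[ z ← elements ] (sgn x y * G x y (E (G y z (φ z))) w)
    summand y = begin
      sgn x y * G x y (E (Ψ y)) w
        ≈⟨ *-congˡ (cong L (Ψ-recursion y) w) ⟩
      sgn x y * G x y (E (λ u → ∑[ z ← elements ] G y z (φ z) u)) w
        ≈⟨ *-congˡ (∑-homo L elements (λ z → G y z (φ z)) w) ⟩
      sgn x y * (∑[ z ← elements ] G x y (E (G y z (φ z))) w)
        ≈⟨ ∑-*ˡ elements _ _ ⟨
      ∑[ z ← elements ] (sgn x y * G x y (E (G y z (φ z))) w) ∎
      where L = ∘-linear (G-linear x y) E-linear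

  -- The doubled recursion and the parity of its exponents.

  2Ψ-summand : V → V → Series AB
  2Ψ-summand x z w = G x z (φ z) w - sgn x z * (G x z (φ z) w + G x z (E (Ψ z)) w)

  2Ψ-recursion : ∀ x w → Ψ x w + Ψ x w ≈ ∑[ z ← elements ] 2Ψ-summand x z w
  2Ψ-recursion x w = begin
    Ψ x w + Ψ x w
      -- With `a` the signed sum over `φ`, the inner term `- (a + p)` is the value that `Ψ-relation`
      -- gives to the signed sum over `E Ψ`.
      ≈⟨ solve 2 (λ p a → p :+ p := p :- (a :+ :- (a :+ p))) refl (Ψ x w) (∑[ z ← elements ] (sgn x z * Gφ z)) ⟩
    Ψ x w - ((∑[ z ← elements ] (sgn x z * Gφ z)) - ((∑[ z ← elements ] (sgn x z * Gφ z)) + Ψ x w))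
      ≈⟨ +-cong (Ψ-recursion x w) (-‿cong (+-congˡ (sym (Ψ-relation x w)))) ⟩
    (∑[ z ← elements ] Gφ z) - ((∑[ z ← elements ] (sgn x z * Gφ z)) + (∑[ z ← elements ] (sgn x z * GEΨ z)))
      ≈⟨ +-congˡ (-‿cong (trans (sym (∑-+ elements _ _)) (∑-cong elements λ z → sym (distribˡ _ _ _)))) ⟩
    (∑[ z ← elements ] Gφ z) - (∑[ z ← elements ] (sgn x z * (Gφ z + GEΨ z)))
      ≈⟨ +-congˡ (∑-neg elements _) ⟨
    (∑[ z ← elements ] Gφ z) + (∑[ z ← elements ] (- (sgn x z * (Gφ z + GEΨ z))))
      ≈⟨ ∑-+ elements _ _ ⟨
    ∑[ z ← elements ] 2Ψ-summand x z w ∎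
    where
    Gφ GEΨ : V → A
    Gφ z = G x z (φ z) w
    GEΨ z = G x z (E (Ψ z)) w

  -1*-1≈1 : - 1# * - 1# ≈ 1#
  -1*-1≈1 = trans (solve 1 (λ o → :- o :* :- o := o :* o) refl 1#) (*-identityˡ 1#)

  -- The parity of `n`, recorded by the sign it gives and by the even power, `n` or `n + 1`, that
  -- preserves cd-polynomials.
  CDParity : ℕ → Set
  CDParity n = ((- 1#) ^ n ≈ 1#   × (∀ {s} → IsCD s → IsCD (E^ n s))) ⊎
               ((- 1#) ^ n ≈ - 1# × (∀ {s} → IsCD s → IsCD (E^ (suc n) s)))

  E^-isCD-parity : ∀ n → CDParity n
  E^-isCD-parity zero = inj₁ (refl , λ cd → cd)
  E^-isCD-parity (suc n) with E^-isCD-parity n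
  ... | inj₁ (even , cd) = inj₂ (trans (*-congˡ even) (*-identityʳ _) , λ cd-s → E²-isCD (cd cd-s))
  ... | inj₂ (odd  , cd) = inj₁ (trans (*-congˡ odd) -1*-1≈1 , cd)

  ρ≡suc-exponent : ∀ {x z} → x < z → ρ[ x , z ] ≡ suc (exponent x z)
  ρ≡suc-exponent x<z = ≡.sym (ℕ.m+[n∸m]≡n (ℕ.m<n⇒0<n∸m (ρ-mono x<z)))

  2Ψ-summand-≮ : ∀ {x z} → ¬ x < z → ∀ w → 2Ψ-summand x z w ≈ 0#
  2Ψ-summand-≮ {x} {z} x≮z w = trans
    (+-cong (G≈0 x≮z _ w) (-‿cong (*-congˡ (+-cong (G≈0 x≮z _ w) (G≈0 x≮z _ w)))))
    (solve 1 (λ s → con ℤ.0ℤ :- s :* (con ℤ.0ℤ :+ con ℤ.0ℤ) := con ℤ.0ℤ) refl (sgn x z))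

  -- For odd ρ[ x , z ] the summand is G (2φ + E Ψ), where 2φ + E Ψ = 2δ + 𝐜 Ψ.
  2Ψ-summand-odd : ∀ x z → sgn x z ≈ - 1# →
    2Ψ-summand x z ≐ G x z (λ u → (δ z 1̂ + δ z 1̂) * one u + C (Ψ z) u)
  2Ψ-summand-odd x z sgn≈-1 w = sym (identity w)
    where
    L = G-linear x z
    2φ+EΨ : ∀ u → φ z u + (φ z u + E (Ψ z) u) ≈ (δ z 1̂ + δ z 1̂) * one u + C (Ψ z) u
    2φ+EΨ u = trans
      (solve 4 (λ d o b e → (d :* o :+ b) :+ ((d :* o :+ b) :+ e) := (d :+ d) :* o :+ (b :+ b :+ e)) refl
        (δ z 1̂) (one u) (shift 𝐛 (Ψ z) u) (E (Ψ z) u))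
      (+-congˡ (2𝐛+E≈C (Ψ z) u))
    identity : ∀ w → G x z (λ u → (δ z 1̂ + δ z 1̂) * one u + C (Ψ z) u) w ≈ 2Ψ-summand x z w
    identity w = begin
      G x z (λ u → (δ z 1̂ + δ z 1̂) * one u + C (Ψ z) u) w           ≈⟨ cong L 2φ+EΨ w ⟨
      G x z (λ u → φ z u + (φ z u + E (Ψ z) u)) w                   ≈⟨ trans (+-homo L _ _ w) (+-congˡ (+-homo L _ _ w)) ⟩
      G x z (φ z) w + (G x z (φ z) w + G x z (E (Ψ z)) w)           ≈⟨ +-congˡ (*-identityˡ _) ⟨
      G x z (φ z) w + 1# * (G x z (φ z) w + G x z (E (Ψ z)) w)
        ≈⟨ +-congˡ (solve 2 (λ o a → o :* a := :- (:- o :* a)) refl 1# _) ⟩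
      G x z (φ z) w - - 1# * (G x z (φ z) w + G x z (E (Ψ z)) w)    ≈⟨ +-congˡ (-‿cong (*-congʳ sgn≈-1)) ⟨
      2Ψ-summand x z w                                              ∎

  -- With sign plus the two terms in `φ` cancel. The factor 𝐚 - 𝐛 of the remaining term joins the
  -- power in `G`.
  2Ψ-summand-even : ∀ x z → sgn x z ≈ 1# →
    2Ψ-summand x z ≐ λ w → - η x z * E^ (suc (exponent x z)) (Ψ z) w
  2Ψ-summand-even x z sgn≈1 w = sym (identity w)
    where
    E^-E : E^ (exponent x z) (E (Ψ z)) ≡ E^ (suc (exponent x z)) (Ψ z)
    E^-E = ≡.trans (E^-+ (exponent x z) 1 (Ψ z)) (≡.cong (λ k → E^ k (Ψ z)) (ℕ.+-comm (exponent x z) 1))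
    identity : ∀ w → - η x z * E^ (suc (exponent x z)) (Ψ z) w ≈ 2Ψ-summand x z w
    identity w = begin
      - η x z * E^ (suc (exponent x z)) (Ψ z) w                     ≡⟨ ≡.cong (λ e → - η x z * e w) E^-E ⟨
      - η x z * E^ (exponent x z) (E (Ψ z)) w
        ≈⟨ solve 3 (λ h e p → :- h :* e := p :- (p :+ h :* e)) refl (η x z) _ (G x z (φ z) w) ⟩
      G x z (φ z) w - (G x z (φ z) w + G x z (E (Ψ z)) w)           ≈⟨ +-congˡ (-‿cong (*-identityˡ _)) ⟨
      G x z (φ z) w - 1# * (G x z (φ z) w + G x z (E (Ψ z)) w)      ≈⟨ +-congˡ (-‿cong (*-congʳ sgn≈1)) ⟨
      2Ψ-summand x z w                                              ∎

  -- `exponent` is one less than ρ(x,z), so its parity is the opposite one. For odd ρ(x,z) the even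
  -- power ρ - 1 acts on 2δ + 𝐜Ψ, for even ρ(x,z) the even power ρ acts on Ψ.
  2Ψ-summand-isCD : ∀ x z → (x < z → IsCD (Ψ z)) → IsCD (2Ψ-summand x z)
  2Ψ-summand-isCD x z cd = case x <? z of λ where
      (no x≮z)  → zero-isCD (2Ψ-summand-≮ x≮z)
      (yes x<z) → parity x<z (E^-isCD-parity (exponent x z))
    where
    sgn≡ : x < z → sgn x z ≈ - 1# * (- 1#) ^ exponent x z
    sgn≡ x<z = reflexive (≡.cong ((- 1#) ^_) (ρ≡suc-exponent x<z))
    parity : x < z → CDParity (exponent x z) → IsCD (2Ψ-summand x z)
    parity x<z (inj₁ (even , cd-E^)) = IsCD-resp-≐
      (λ w → sym (2Ψ-summand-odd x z (trans (sgn≡ x<z) (trans (*-congˡ even) (*-identityʳ _))) w))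
      (*-isCD (η x z) (cd-E^ (+-isCD (*-isCD (δ z 1̂ + δ z 1̂) one-isCD) (letter-isCD 𝐜 (cd x<z)))))
    parity x<z (inj₂ (odd , cd-E^)) = IsCD-resp-≐
      (λ w → sym (2Ψ-summand-even x z (trans (sgn≡ x<z) (trans (*-congˡ odd) -1*-1≈1)) w))
      (*-isCD (- η x z) (cd-E^ (cd x<z)))

  module _ (½ : A) (½+½≈1 : ½ + ½ ≈ 1#) where

    Ψ-isCD : ∀ x → IsCD (Ψ x)
    -- The recursion is structural in a strict bound on `above x`, which drops with every `x < z`;
    -- the bound zero is impossible.
    Ψ-isCD x = go x (suc (above x)) ℕ.≤-refl
      where
      halve : ∀ a → ½ * (a + a) ≈ a
      halve a = trans (solve 2 (λ h a → h :* (a :+ a) := (h :+ h) :* a) refl ½ a)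
        (trans (*-congʳ ½+½≈1) (*-identityˡ a))
      go : ∀ x n → above x ℕ.< n → IsCD (Ψ x)
      go x (suc n) above<n = IsCD-resp-≐ (λ w → trans (*-congˡ (sym (2Ψ-recursion x w))) (halve (Ψ x w)))
        (*-isCD ½ (∑-isCD elements λ z → 2Ψ-summand-isCD x z λ x<z →
          go z n (ℕ.<-≤-trans (above-< x<z) (ℕ.s≤s⁻¹ above<n))))

-- Existence, uniqueness and integrality of the cd-index when 2 is invertible.

module CDIndex (R : CommutativeRing 0ℓ 0ℓ) where

  open CommutativeRing R renaming (Carrier to A)
  open IntegerHomomorphism R
  open Series R
  open CDExpansion R
  open NonCommutativePolynomial.Coefficients R _≟ᴬᴮ_ using (coefficient)
  open QuasiGraded R
  open QuasiGradedPoset hiding (Carrier; _≤_)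

  -- The inductive construction provides the polynomial. Two polynomials with the same expansion
  -- have the same coefficients because `extract` recovers these from the expansion.
  cd-index-exists-uniquely : (½ : A) → ½ + ½ ≈ 1# → ∀ P → Eulerian P → ∀ x y →
                             ∃! _≈ᶜᴰ_ (λ Φ → expand Φ ≈ᴬᴮ ab-index P x y)
  cd-index-exists-uniquely ½ ½+½≈1 P eulerian x y = Φ , Φ≈ , λ {Φ′} Φ′≈ u →
    trans (sym (extract-expand Φ u))
      (trans (Linear.cong extract-linear (λ w → trans (Φ≈ w) (sym (Φ′≈ w))) u) (extract-expand Φ′ u))
    where
    cd : IsCD (coefficient (ab-index P x y))
    cd = EulerianABIndex.Ψ-isCD R P eulerian y ½ ½+½≈1 x
    Φ = proj₁ cd
    Φ≈ = proj₂ cd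

  -- The construction of the cd-index divides by 2 and so does not show integrality. It is read off
  -- the ab-index, whose coefficients are integers, by means of `extract`.
  cd-index-integral : ∀ P → IntegerValued P → ∀ x y Φ → expand Φ ≈ᴬᴮ ab-index P x y → IntegerCoefficients Φ
  cd-index-integral P integral x y Φ Φ≈ u =
    IsInteger-resp-≈ (trans (sym (Linear.cong extract-linear Φ≈ u)) (extract-expand Φ u))
      (extract-isInteger (ABIndex.Ψ-isInteger R P y integral x) u)

-- Specialisation to complex coefficients.

open QuasiGraded ℂ-commutativeRing
open QuasiGradedPoset

theorem4p2 : (P : QuasiGradedPoset) → Eulerian P →
    (0̂ 1̂ : Carrier P) → Minimum (_≤_ P) 0̂ → Maximum (_≤_ P) 1̂ → _<_ P 0̂ 1̂ →
    ∃! _≈ᶜᴰ_ (λ Φ → expand Φ ≈ᴬᴮ ab-index P 0̂ 1̂) ×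
    (IntegerValued P → ∀ Φ → expand Φ ≈ᴬᴮ ab-index P 0̂ 1̂ → IntegerCoefficients Φ)
theorem4p2 P eulerian 0̂ 1̂ _ _ _ =
    cd-index-exists-uniquely half half+half≋1 P eulerian 0̂ 1̂
  , λ integral → cd-index-integral P integral 0̂ 1̂
  where
  open CDIndex ℂ-commutativeRing
  half : Complex.ℂ
  half = Real.fromℚ ½ Complex.+i Real.fromℚ 0ℚ
  half+half≋1 : CommutativeRing._≈_ ℂ-commutativeRing
    (CommutativeRing._+_ ℂ-commutativeRing half half) (CommutativeRing.1# ℂ-commutativeRing)
  -- The real and imaginary parts are constant sequences, so both equations hold by evaluating
  -- rational sums.
  half+half≋1 = Real.pointwise (λ _ → ≡.refl) Complex., Real.pointwise (λ _ → ≡.refl)
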